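{- Let $n$ be a positive integer and let $C_n$ be the cyclic group of order $n$. Then $C_n$ is an NDCI-group if and only if $8\nmid n$. Moreover, $C_n$ is an NCI-group if and only if either $n=8$ or $8\nmid n$.
   Context: All groups are finite and all (di)graphs are finite without loops or multiple arcs. For a group $G$ and a subset $S\subseteq G$ with $1\notin S$, the Cayley digraph $\mathrm{Cay}(G,S)$ has vertex set $G$ and arc set $\{(g,sg)\mid g\in G, s\in S\}$; if $S=S^{ -1}$ it is regarded as an undirected graph and called a Cayley graph. The right regular representation is $R(G)=\{R(g)\mid g\in G\}$, where $x^{R(g)}=xg$; it is a subgroup of $\mathrm{Aut}(\mathrm{Cay}(G,S))$. A Cayley (di)graph $\mathrm{Cay}(G,S)$ is called normal if $R(G)$ is a normal subgroup of $\mathrm{Aut}(\mathrm{Cay}(G,S))$. $\mathrm{Cay}(G,S)$ is called a CI-digraph (CI-graph when $S=S^{ -1}$) if for every subset $T\subseteq G$, $\mathrm{Cay}(G,S)\cong\mathrm{Cay}(G,T)$ implies $T=S^\sigma$ for some $\sigma\in\mathrm{Aut}(G)$. A group $G$ is an NDCI-group if every normal Cayley digraph of $G$ is a CI-digraph, and an NCI-group if every normal Cayley graph of $G$ is a CI-graph. -}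

module Defs where

open import Data.Nat using (ℕ; suc; _+_; NonZero)
open import Data.Nat.DivMod using (_%_; m%n<n)
open import Data.Fin using (Fin; zero; toℕ; fromℕ<)
open import Data.Fin.Subset using (Subset; _∈_; _∉_)
open import Data.Fin.Permutation using (Permutation′; _⟨$⟩ʳ_; _⟨$⟩ˡ_)
open import Data.Product using (Σ; ∃; _×_)
open import Relation.Binary.PropositionalEquality using (_≡_)
open import Function.Bundles using (_⇔_)

module _ (m : ℕ) where

  n : ℕ
  n = suc m

  _⊕_ : Fin n → Fin n → Fin n
  x ⊕ y = fromℕ< (m%n<n (toℕ x + toℕ y) n)

  -- inverse: -x mod n is the unique y with y ⊕ x ≡ zero
  -- S is inverse-closed (S = S⁻¹)
  Symmetric : Subset n → Set
  Symmetric S = ∀ x y → (y ⊕ x) ≡ zero → x ∈ S → y ∈ S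

  Arc : Subset n → Fin n → Fin n → Set
  Arc S g h = ∃ λ s → s ∈ S × h ≡ (s ⊕ g)

  IsDigraphAut : Subset n → Permutation′ n → Set
  IsDigraphAut S σ = ∀ x y → Arc S x y ⇔ Arc S (σ ⟨$⟩ʳ x) (σ ⟨$⟩ʳ y)

  Isomorphic : Subset n → Subset n → Set
  Isomorphic S T = ∃ λ (φ : Permutation′ n) →
    ∀ x y → Arc S x y ⇔ Arc T (φ ⟨$⟩ʳ x) (φ ⟨$⟩ʳ y)

  -- right regular representation: R(g) : x ↦ x g
  -- Cay(C_n,S) is normal: R(G) is normal in Aut(Cay(C_n,S)),
  -- i.e. σ⁻¹ R(g) σ ∈ R(G) for every automorphism σ and every g.
  IsNormal : Subset n → Set
  IsNormal S = ∀ (σ : Permutation′ n) → IsDigraphAut S σ →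
    ∀ g → ∃ λ h → ∀ x → σ ⟨$⟩ʳ ((σ ⟨$⟩ˡ x) ⊕ g) ≡ (x ⊕ h)

  IsGroupAut : Permutation′ n → Set
  IsGroupAut σ = ∀ x y → σ ⟨$⟩ʳ (x ⊕ y) ≡ ((σ ⟨$⟩ʳ x) ⊕ (σ ⟨$⟩ʳ y))

  _≡Image_under_ : Subset n → Subset n → Permutation′ n → Set
  T ≡Image S under σ = ∀ t → t ∈ T ⇔ (∃ λ s → s ∈ S × σ ⟨$⟩ʳ s ≡ t)

  IsCI : Subset n → Set
  IsCI S = ∀ (T : Subset n) → Isomorphic S T →
    ∃ λ (σ : Permutation′ n) → IsGroupAut σ × (T ≡Image S under σ)

  NDCI : Set
  NDCI = ∀ (S : Subset n) → zero ∉ S → IsNormal S → IsCI S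

  NCI : Set
  NCI = ∀ (S : Subset n) → zero ∉ S → Symmetric S → IsNormal S → IsCI S

{-# OPTIONS --safe #-}

-- Let n = |C|.  If Cay(C, S) is normal, its automorphisms are affine.  An isomorphism φ from Cay(C, S) to
-- Cay(C, T) conjugates the translation by 1 into an affine automorphism x ↦ b + a x acting as an n-cycle, and φ
-- is affine as soon as a ≡ 1, in which case T is the image of S under a group automorphism.  Being an n-cycle
-- forces a ≡ 1 modulo every prime divisor of n (and modulo 4 if 4 ∣ n) and a ^ n ≡ 1.  If a ≢ 1, some power
-- 1 + t of a has prime order r, and if 8 ∤ n then r is odd and r t ≡ 0; now S \ r C is a union of cosets of ⟨t⟩, so
-- moving the multiples of r by t and fixing everything else is an automorphism which is not affine.  For n = 8
-- and S = - S the same map with r = t = 2 works.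
--
-- Conversely let 8 ∣ n and h = n / 2.  The map ψ x = x + ⌊ x / 2 ⌋ h sends Cay(C, {1, 1 + h, 2}) to
-- Cay(C, {1, 1 + h, 2 + h}), and these sets are not equivalent.  The first digraph is normal because the two short
-- sides of a transitive triangle are always equal, so every automorphism has constant increments.  For n > 8 the
-- graph with connection set {± 1, ± 1 + h, ± 2, h} behaves in the same way: the edges ± 2 are recognised by having only
-- two common neighbours.

module Submission where

open import Defs
open import Data.Nat using (ℕ; suc)
open import Data.Nat.Divisibility using (_∣_)
open import Data.Product using (_×_)
open import Data.Sum using (_⊎_)
open import Relation.Nullary using (¬_)
open import Relation.Binary.PropositionalEquality using (_≡_)
open import Function.Bundles using (_⇔_)

open import Data.Empty using (⊥; ⊥-elim)
open import Data.Fin as Fin using (Fin; toℕ; fromℕ<)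
open import Data.Fin.Permutation using (Permutation′; permutation; _⟨$⟩ʳ_; _⟨$⟩ˡ_; inverseˡ; inverseʳ; flip; _∘ₚ_)
open import Data.Fin.Properties using (toℕ-injective; toℕ-fromℕ<; toℕ<n)
open import Data.Fin.Subset using (Subset; _∈_; _∉_; ⁅_⁆; _∪_) renaming (⊥ to ∅)
open import Data.Fin.Subset.Properties using (∉⊥; x∈⁅x⁆; x∈⁅y⁆⇒x≡y; x∈p∪q⁺; x∈p∪q⁻)
open import Data.Integer as ℤ using (ℤ; +_; -_; _+_; _-_; _*_; _^_; 0ℤ; 1ℤ; ∣_∣)
open import Data.Integer.Divisibility.Signed as Signed using (divides; ∣-refl; ∣-trans; _∣?_)
  renaming (_∣_ to infix 4 _∣ℤ_; ∣m∣n⇒∣m+n to infixr 6 _∣+_; ∣n⇒∣m*n to infixr 7 _*∣_)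
import Data.Integer.Coprimality as ℤC
open import Data.Integer.DivMod using (_%ℕ_; _/ℕ_; n%ℕd<d; a≡a%ℕn+[a/ℕn]*n)
import Data.Integer.Properties as ℤₚ
open import Data.Integer.Tactic.RingSolver using (solve-∀)
open import Data.List using (List; []; _∷_)
open import Data.List.Membership.Propositional using (find) renaming (_∈_ to _∈ₗ_)
open import Data.List.Relation.Unary.All as All using (All; []; _∷_)
open import Data.List.Relation.Unary.Any as Any using (Any; here; there)
open import Data.Nat as ℕ using (zero)
open import Data.Nat.Coprimality using (Coprime; coprime-Bézout)
open import Data.Nat.DivMod using (m<n⇒m%n≡m)
open import Data.Nat.Divisibility as ℕ∣ using (∣1⇒≡1; >⇒∤)
open import Data.Nat.GCD using (module Bézout)
open import Data.Nat.ListAction using (product)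
open import Data.Nat.Primality using (Prime; prime[2]; ¬prime[1]; prime⇒irreducible; prime⇒nonZero; euclidsLemma)
open import Data.Nat.Primality.Factorisation using (factorise)
import Data.Nat.Properties as ℕₚ
open import Data.Product using (∃; ∃₂; _,_; proj₁; proj₂)
open import Data.Sum as Sum using (inj₁; inj₂)
open import Function.Bundles using (mk⇔; Equivalence)
open import Relation.Binary.PropositionalEquality using (_≢_; refl; sym; trans; cong; cong₂; subst; subst₂)
open import Relation.Nullary using (Dec; yes; no; contradiction)
open import Relation.Nullary.Decidable using (from-no; from-yes; _×-dec_; _⊎-dec_; _→-dec_; ¬?)
open import Relation.Unary using (Decidable)

open Equivalence using (to; from)

-- Congruences, prime divisors and inverses over the integers.

infix 4 _≅_[_]
_≅_[_] : ℤ → ℤ → ℤ → Set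
i ≅ j [ k ] = k ∣ℤ i - j

∣-resp : ∀ {k x z} → z ≡ x → k ∣ℤ x → k ∣ℤ z
∣-resp eq = subst (_ ∣ℤ_) (sym eq)

≅-refl : ∀ {k} i → i ≅ i [ k ]
≅-refl i = ∣-resp (ℤₚ.+-inverseʳ i) (divides 0ℤ refl)

≅-reflexive : ∀ {k i j} → i ≡ j → i ≅ j [ k ]
≅-reflexive {i = i} refl = ≅-refl i

≅-sym : ∀ {k} i j → i ≅ j [ k ] → j ≅ i [ k ]
≅-sym i j d = ∣-resp (eq i j) (- 1ℤ *∣ d)
  where
  eq : ∀ i j → j - i ≡ - 1ℤ * (i - j)
  eq = solve-∀

≅-trans : ∀ {k} i j l → i ≅ j [ k ] → j ≅ l [ k ] → i ≅ l [ k ]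
≅-trans i j l d e = ∣-resp (eq i j l) (d ∣+ e)
  where
  eq : ∀ i j l → i - l ≡ (i - j) + (j - l)
  eq = solve-∀

prime∣⇒≡ : ∀ {p q} → Prime p → Prime q → p ∣ q → p ≡ q
prime∣⇒≡ pp pq p∣q with prime⇒irreducible pq p∣q
... | inj₁ refl = contradiction pp ¬prime[1]
... | inj₂ eq   = eq

prime∤1 : ∀ {p} → Prime p → ¬ + p ∣ℤ 1ℤ
prime∤1 pp d with ∣1⇒≡1 (Signed.∣⇒∣ᵤ d)
... | refl = ¬prime[1] pp

primeDivisor : ∀ k → k ≢ 1 → ∃ λ p → Prime p × p ∣ k
primeDivisor zero    _   = 2 , prime[2] , 2 ℕ∣.∣0
primeDivisor (suc k) k≢1 with factorise (suc k)
... | record { factors = [] ; isFactorisation = eq } = contradiction eq k≢1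
... | record { factors = p ∷ ps ; isFactorisation = eq ; factorsPrime = pp ∷ _ } =
  p , pp , ℕ∣.divides (product ps) (trans eq (ℕₚ.*-comm p (product ps)))

-- Coprimality is phrased through primes because the hypotheses it is derived from, such as `t`
-- vanishing modulo each prime divisor of `k`, speak about one prime at a time.
NoCommonPrime : ℤ → ℤ → Set
NoCommonPrime k u = ∀ p → Prime p → + p ∣ℤ k → ¬ + p ∣ℤ u

noCommonPrime⇒coprime : ∀ k u → NoCommonPrime k u → Coprime ∣ k ∣ ∣ u ∣
noCommonPrime⇒coprime k u h {d} (d∣k , d∣u) with d ℕ.≟ 1
... | yes d≡1 = d≡1
... | no  d≢1 with primeDivisor d d≢1
...   | p , pp , p∣d = ⊥-elim (h p pp (Signed.∣ᵤ⇒∣ (ℕ∣.∣-trans p∣d d∣k)) (Signed.∣ᵤ⇒∣ (ℕ∣.∣-trans p∣d d∣u)))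

∣-cancel-coprime : ∀ k u x → NoCommonPrime k u → k ∣ℤ u * x → k ∣ℤ x
∣-cancel-coprime k u x h d =
  Signed.∣ᵤ⇒∣ (ℤC.coprime-divisor k u x (noCommonPrime⇒coprime k u h) (Signed.∣⇒∣ᵤ d))

bézout-inverse : ∀ m x → Coprime m ∣ x ∣ → ∃ λ c → x * c ≅ 1ℤ [ + m ]
-- Bézout's identity is about ∣ x ∣; the quotient `q` with ∣ x ∣ ≡ q x carries the sign over to the
-- inverse of `x`.
bézout-inverse m x cop with Signed.m∣∣m∣ {x}
... | divides q ∣x∣≡qx with coprime-Bézout cop
...   | Bézout.+- a b eq = - (b' * q) , divides (- + a) (goal (+ a) b' (+ m) (+ ∣ x ∣) x q ∣x∣≡qx eq′)
  where
  b' = + b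
  eq′ : + 1 + b' * + ∣ x ∣ ≡ + a * + m
  eq′ = trans (cong (_+_ (+ 1)) (sym (ℤₚ.pos-* b ∣ x ∣))) (trans (cong +_ eq) (ℤₚ.pos-* a m))
  goal : ∀ a b m y x q → y ≡ q * x → + 1 + b * y ≡ a * m → x * - (b * q) - 1ℤ ≡ - a * m
  goal a b m .(q * x) x q refl e = trans (s b x q) (trans (cong -_ e) (ℤₚ.neg-distribˡ-* a m))
    where
    s : ∀ b x q → x * - (b * q) - 1ℤ ≡ - (+ 1 + b * (q * x))
    s = solve-∀
...   | Bézout.-+ a b eq = b' * q , divides (+ a) (goal (+ a) b' (+ m) (+ ∣ x ∣) x q ∣x∣≡qx eq′)
  where
  b' = + b
  eq′ : + 1 + + a * + m ≡ b' * + ∣ x ∣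
  eq′ = trans (cong (_+_ (+ 1)) (sym (ℤₚ.pos-* a m))) (trans (cong +_ eq) (ℤₚ.pos-* b ∣ x ∣))
  goal : ∀ a b m y x q → y ≡ q * x → + 1 + a * m ≡ b * y → x * (b * q) - 1ℤ ≡ a * m
  goal a b m .(q * x) x q refl e = trans (s b x q) (trans (cong (_- 1ℤ) (sym e)) (s₂ a m))
    where
    s : ∀ b x q → x * (b * q) - 1ℤ ≡ b * (q * x) - 1ℤ
    s = solve-∀
    s₂ : ∀ a m → + 1 + a * m - 1ℤ ≡ a * m
    s₂ = solve-∀

inverse-mod-prime : ∀ {p} x → Prime p → ¬ + p ∣ℤ x → ∃ λ c → x * c ≅ 1ℤ [ + p ]
inverse-mod-prime {p} x pp p∤x = bézout-inverse p x cop
  where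
  cop : Coprime p ∣ x ∣
  cop (d∣p , d∣x) with prime⇒irreducible pp d∣p
  ... | inj₁ d≡1  = d≡1
  ... | inj₂ refl = ⊥-elim (p∤x (Signed.∣ᵤ⇒∣ d∣x))

residue : ∀ m .{{_ : ℕ.NonZero m}} i → i ≅ + (i %ℕ m) [ + m ]
residue m i = divides (i /ℕ m)
  (trans (cong (_- + (i %ℕ m)) (a≡a%ℕn+[a/ℕn]*n i m)) (eq (+ (i %ℕ m)) (i /ℕ m * + m)))
  where
  eq : ∀ x y → x + y - x ≡ y
  eq = solve-∀

parity : ∀ i → ∃ λ j → i ≡ j + j ⊎ i ≡ j + j + 1ℤ
parity i with i %ℕ 2 | a≡a%ℕn+[a/ℕn]*n i 2 | n%ℕd<d i 2
... | 0 | eq | _ = i /ℕ 2 , inj₁ (trans eq (s (i /ℕ 2)))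
  where
  s : ∀ q → 0ℤ + q * + 2 ≡ q + q
  s = solve-∀
... | 1 | eq | _ = i /ℕ 2 , inj₂ (trans eq (s (i /ℕ 2)))
  where
  s : ∀ q → 1ℤ + q * + 2 ≡ q + q + 1ℤ
  s = solve-∀
... | suc (suc _) | _ | ℕ.s≤s (ℕ.s≤s ())

-- Roots of unity that are trivial modulo every prime divisor of the modulus.

primeOrderPower : ∀ {k a} N .{{_ : ℕ.NonZero N}} → a ^ N ≅ 1ℤ [ k ] → ¬ a ≅ 1ℤ [ k ] →
  ∃₂ λ r M → Prime r × r ∣ N × ¬ (a ^ M ≅ 1ℤ [ k ]) × (a ^ M) ^ r ≅ 1ℤ [ k ]
primeOrderPower {k} {a} N aᴺ a≇1 with factorise N
... | record { factors = ps ; isFactorisation = refl ; factorsPrime = pps } = go ps pps aᴺ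
  where
  go : ∀ ps → All Prime ps → a ^ product ps ≅ 1ℤ [ k ] →
    ∃₂ λ r M → Prime r × r ∣ product ps × ¬ (a ^ M ≅ 1ℤ [ k ]) × (a ^ M) ^ r ≅ 1ℤ [ k ]
  go []       _          d = contradiction (subst (λ x → x ≅ 1ℤ [ k ]) (ℤₚ.*-identityʳ a) d) a≇1
  -- The prime factors of the exponent are removed one by one. The first removal that makes the
  -- power nontrivial yields `r`, and the product of the remaining factors is `M`.
  go (p ∷ ps) (pp ∷ pps) d with k ∣? (a ^ product ps - 1ℤ)
  ... | no  ≇1 = p , product ps , pp , ℕ∣.m∣m*n (product ps) , ≇1 ,
    subst (λ x → x ≅ 1ℤ [ k ])
      (trans (cong (a ^_) (ℕₚ.*-comm p (product ps))) (sym (ℤₚ.^-*-assoc a (product ps) p))) d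
  ... | yes ≅1 with go ps pps ≅1
  ...   | r , M , pr , r∣ , rest = r , M , pr , ℕ∣.∣-trans r∣ (ℕ∣.n∣m*n p) , rest

-- `c` is the binomial coefficient of `m` over 2, pinned down by its double to avoid a division; `w`
-- collects the terms of degree three and higher.
binomial-expansion : ∀ t m → ∃₂ λ c w →
  (1ℤ + t) ^ m ≡ 1ℤ + + m * t + c * (t * t) + t * t * t * w × c + c ≡ + m * (+ m - 1ℤ)
binomial-expansion t zero = 0ℤ , 0ℤ , s t , refl
  where
  s : ∀ t → 1ℤ ≡ 1ℤ + 0ℤ * t + 0ℤ * (t * t) + t * t * t * 0ℤ
  s = solve-∀
binomial-expansion t (suc m) with binomial-expansion t m
... | c , w , eq , c₂ = c + + m , c + w + t * w ,
  trans (cong ((1ℤ + t) *_) eq) (s t (+ m) c w) ,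
  trans (s₁ c (+ m)) (trans (cong (_+ (+ m + + m)) c₂) (s₂ (+ m)))
  where
  s : ∀ t m c w → (1ℤ + t) * (1ℤ + m * t + c * (t * t) + t * t * t * w) ≡
    1ℤ + (1ℤ + m) * t + (c + m) * (t * t) + t * t * t * (c + w + t * w)
  s = solve-∀
  s₁ : ∀ c m → (c + m) + (c + m) ≡ c + c + (m + m)
  s₁ = solve-∀
  s₂ : ∀ m → m * (m - 1ℤ) + (m + m) ≡ (1ℤ + m) * (1ℤ + m - 1ℤ)
  s₂ = solve-∀

double-injective : ∀ {x y} → x + x ≡ y + y → x ≡ y
double-injective {x} {y} eq = ℤₚ.*-cancelˡ-≡ (+ 2) x y (trans (s x) (trans eq (sym (s y))))
  where
  s : ∀ x → + 2 * x ≡ x + x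
  s = solve-∀

-- (1 + t) ^ r - 1 = t r u with u ≡ 1 modulo every prime dividing k.
root-of-unity-odd : ∀ {k t r} → Prime r → r ≢ 2 → + r ∣ℤ k → (∀ p → Prime p → + p ∣ℤ k → + p ∣ℤ t) →
  (1ℤ + t) ^ r ≅ 1ℤ [ k ] → k ∣ℤ t * + r
root-of-unity-odd {k} {t} {r} pr r≢2 r∣k p∣t d with parity (+ r)
... | j , inj₁ r≡2j = contradiction (sym (prime∣⇒≡ prime[2] pr (Signed.∣⇒∣ᵤ (divides j (trans r≡2j (s j)))))) r≢2
  where
  s : ∀ j → j + j ≡ j * + 2
  s = solve-∀
... | j , inj₂ r≡2j+1 with binomial-expansion t r | p∣t r pr r∣k
...   | c , w , eq , c₂ | divides t′ t≡t′r =
  ∣-cancel-coprime k (1ℤ + t * v) (t * + r) coprime (∣-resp (sym expand) d)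
  where
  v = j + t′ * w
  -- Oddness of `r` enters here: half of r (r - 1) is r j. The cubic term receives its factor `r`
  -- from one of its factors `t`.
  c≡rj : c ≡ + r * j
  c≡rj = double-injective (trans c₂ (trans (cong (λ x → + r * (x - 1ℤ)) r≡2j+1) (s (+ r) j)))
    where
    s : ∀ r j → r * (j + j + 1ℤ - 1ℤ) ≡ r * j + r * j
    s = solve-∀
  expand : (1ℤ + t) ^ r - 1ℤ ≡ (1ℤ + t * v) * (t * + r)
  expand = trans (cong (_- 1ℤ) eq) (s t (+ r) t′ c w j t≡t′r c≡rj)
    where
    s₀ : ∀ t r t′ w j → 1ℤ + r * t + r * j * (t * t) + (t′ * r) * t * t * w - 1ℤ ≡ (1ℤ + t * (j + t′ * w)) * (t * r)
    s₀ = solve-∀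
    s : ∀ t r t′ c w j → t ≡ t′ * r → c ≡ r * j →
      1ℤ + r * t + c * (t * t) + t * t * t * w - 1ℤ ≡ (1ℤ + t * (j + t′ * w)) * (t * r)
    s t r t′ c w j e refl = trans (cong (λ x → 1ℤ + r * t + r * j * (t * t) + x * t * t * w - 1ℤ) e) (s₀ t r t′ w j)
  coprime : NoCommonPrime k (1ℤ + t * v)
  coprime p pp p∣k p∣u = prime∤1 pp (∣-resp (s t v) (p∣u ∣+ (- v *∣ p∣t p pp p∣k)))
    where
    s : ∀ t v → 1ℤ ≡ 1ℤ + t * v + - v * t
    s = solve-∀

prime∣4⇒≡2 : ∀ {p} → Prime p → + p ∣ℤ + 4 → p ≡ 2
prime∣4⇒≡2 pp p∣4 with euclidsLemma 2 2 pp (Signed.∣⇒∣ᵤ p∣4)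
... | inj₁ p∣2 = prime∣⇒≡ pp prime[2] p∣2
... | inj₂ p∣2 = prime∣⇒≡ pp prime[2] p∣2

-- The hypothesis reads t (2 + t) ≡ 0. As `m` is odd and its primes divide `t`, it is coprime to 2 +
-- t, so m ∣ t. As c ∣ t and `c` is a divisor of 4, hence coprime to `m`, the product divides `t` as
-- well.
square-root-of-unity : ∀ {k t} m c → k ≡ m * c → c ∣ℤ + 4 → ¬ + 2 ∣ℤ m → (∀ p → Prime p → + p ∣ℤ k → + p ∣ℤ t) →
  c ∣ℤ t → (1ℤ + t) ^ 2 ≅ 1ℤ [ k ] → k ∣ℤ t
square-root-of-unity {k} {t} m c refl c∣4 2∤m p∣t (divides q t≡qc) d =
  assemble (∣-cancel-coprime m c q coprime-c (∣-resp (trans (ℤₚ.*-comm c q) (sym t≡qc)) m∣t))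
  where
  assemble : m ∣ℤ q → m * c ∣ℤ t
  assemble (divides q′ q≡q′m) = divides q′ (trans t≡qc (trans (cong (_* c) q≡q′m) (ℤₚ.*-assoc q′ m c)))
  m∣k : m ∣ℤ m * c
  m∣k = divides c (ℤₚ.*-comm m c)
  2-excluded : ∀ {p} → p ≡ 2 → ¬ + p ∣ℤ m
  2-excluded refl = 2∤m
  coprime-c : NoCommonPrime m c
  coprime-c p pp p∣m p∣c = 2-excluded (prime∣4⇒≡2 pp (∣-trans p∣c c∣4)) p∣m
  coprime-2+t : NoCommonPrime m (+ 2 + t)
  coprime-2+t p pp p∣m p∣2+t = 2-excluded (prime∣⇒≡ pp prime[2] (Signed.∣⇒∣ᵤ p∣2)) p∣m
    where
    s : ∀ t → + 2 ≡ + 2 + t + - 1ℤ * t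
    s = solve-∀
    p∣2 : + p ∣ℤ + 2
    p∣2 = ∣-resp (s t) (p∣2+t ∣+ (- 1ℤ *∣ p∣t p pp (∣-trans p∣m m∣k)))
  m∣t : m ∣ℤ t
  m∣t = ∣-cancel-coprime m (+ 2 + t) t coprime-2+t (∣-resp (s t) (∣-trans m∣k d))
    where
    s : ∀ t → (+ 2 + t) * t ≡ (1ℤ + t) * ((1ℤ + t) * 1ℤ) - 1ℤ
    s = solve-∀

-- This is where 8 ∤ k is needed: the 2-part of `k` is 2 or 4, and modulo that `t` vanishes by
-- assumption.
root-of-unity-two : ∀ {k t} → ¬ + 8 ∣ℤ k → + 2 ∣ℤ k → (∀ p → Prime p → + p ∣ℤ k → + p ∣ℤ t) →
  (+ 4 ∣ℤ k → + 4 ∣ℤ t) → (1ℤ + t) ^ 2 ≅ 1ℤ [ k ] → k ∣ℤ t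
root-of-unity-two {k} {t} 8∤k (divides l k≡l*2) p∣t 4∣t d with + 4 ∣? k
... | yes (divides m k≡m*4) =
  square-root-of-unity m (+ 4) k≡m*4 ∣-refl 2∤m p∣t (4∣t (divides m k≡m*4)) d
  where
  2∤m : ¬ + 2 ∣ℤ m
  2∤m (divides q m≡q*2) = 8∤k (divides q (trans k≡m*4 (trans (cong (_* + 4) m≡q*2) (ℤₚ.*-assoc q (+ 2) (+ 4)))))
... | no 4∤k = square-root-of-unity l (+ 2) k≡l*2 (divides (+ 2) refl) 2∤l p∣t (p∣t 2 prime[2] (divides l k≡l*2)) d
  where
  2∤l : ¬ + 2 ∣ℤ l
  2∤l (divides q l≡q*2) = 4∤k (divides q (trans k≡l*2 (trans (cong (_* + 2) l≡q*2) (ℤₚ.*-assoc q (+ 2) (+ 2)))))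

-- Multipliers of affine maps acting as a single cycle.

-- The sequence of iterates of an affine map x ↦ b + a x which permutes the residues modulo k in a single cycle.
module AffineCycle (k a b : ℤ) (g : ℕ → ℤ)
  (step : ∀ i → g (suc i) ≅ b + a * g i [ k ])
  (surjective : ∀ i x → ∃ λ j → g (i ℕ.+ j) ≅ x [ k ])
  where

  -- Were a - 1 invertible modulo `p`, with inverse `c`, the map would have the fixed point - c b
  -- modulo `p`. The orbit reaches it and stays, so x₀ - 1 is never visited afterwards; this is why
  -- `surjective` allows any starting index.
  multiplier≅1-mod-prime : ∀ p → Prime p → + p ∣ℤ k → a ≅ 1ℤ [ + p ]
  multiplier≅1-mod-prime p pp p∣k with + p ∣? (a - 1ℤ)
  ... | yes d = d
  ... | no p∤a-1 with inverse-mod-prime (a - 1ℤ) pp p∤a-1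
  ...   | c , inv = ⊥-elim (prime∤1 pp (∣-resp (s₁ x₀ (g (k₀ ℕ.+ l))) (- 1ℤ *∣ stays l ∣+ ∣-trans p∣k (proj₂ hit))))
    where
    x₀ = - (c * b)
    k₀ = proj₁ (surjective 0 x₀)
    hit = surjective k₀ (x₀ - 1ℤ)
    l = proj₁ hit
    s₁ : ∀ x y → 1ℤ ≡ - 1ℤ * (y - x) + (y - (x - 1ℤ))
    s₁ = solve-∀
    s₂ : ∀ a b c y z → z - - (c * b) ≡
      (z - (b + a * y)) + (a * (y - - (c * b)) + - b * ((a - 1ℤ) * c - 1ℤ))
    s₂ = solve-∀
    stays : ∀ j → g (k₀ ℕ.+ j) ≅ x₀ [ + p ]
    stays zero    rewrite ℕₚ.+-identityʳ k₀ = ∣-trans p∣k (proj₂ (surjective 0 x₀))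
    stays (suc j) rewrite ℕₚ.+-suc k₀ j = ∣-resp (s₂ a b c (g (k₀ ℕ.+ j)) (g (suc (k₀ ℕ.+ j))))
      (∣-trans p∣k (step (k₀ ℕ.+ j)) ∣+ ((a *∣ stays j) ∣+ (- b *∣ inv)))

  -- If a ≡ -1 modulo 4 the map is an involution modulo 4, so its cycles have length at most 2.
  multiplier≅1-mod-4 : + 4 ∣ℤ k → a ≅ 1ℤ [ + 4 ]
  multiplier≅1-mod-4 4∣k with multiplier≅1-mod-prime 2 prime[2] (∣-trans (divides (+ 2) refl) 4∣k)
  ... | divides q a-1≡q*2 with parity q
  ...   | r , inj₁ q≡r+r = divides r (trans a-1≡q*2 (trans (cong (_* + 2) q≡r+r) (s r)))
    where
    s : ∀ r → (r + r) * + 2 ≡ r * + 4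
    s = solve-∀
  -- Both g 0 + 1 and g 0 + 2 are visited, but the only available values are g 0 and g 1, and
  -- neither target is g 0 modulo 4.
  ...   | r , inj₂ q≡r+r+1 = contradiction (hit (g 0 + + 2)) (two-values (hit (g 0 + 1ℤ)))
    where
    4∣a+1 : + 4 ∣ℤ a + 1ℤ
    4∣a+1 = divides (r + 1ℤ) (trans (s₁ a) (trans (cong (_+ + 2) (trans a-1≡q*2 (cong (_* + 2) q≡r+r+1))) (s₂ r)))
      where
      s₁ : ∀ a → a + 1ℤ ≡ a - 1ℤ + + 2
      s₁ = solve-∀
      s₂ : ∀ r → (r + r + 1ℤ) * + 2 + + 2 ≡ (r + 1ℤ) * + 4
      s₂ = solve-∀
    double-step : ∀ i → g (suc (suc i)) ≅ g i [ + 4 ]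
    double-step i = ∣-resp (s a b (g i) (g (suc i)) (g (suc (suc i))))
      (∣-trans 4∣k (step (suc i)) ∣+ ((a *∣ ∣-trans 4∣k (step i)) ∣+ ((b + (a - 1ℤ) * g i) *∣ 4∣a+1)))
      where
      s : ∀ a b x y z → z - x ≡ (z - (b + a * y)) + (a * (y - (b + a * x)) + (b + (a - 1ℤ) * x) * (a + 1ℤ))
      s = solve-∀
    two-cycle : ∀ i → g i ≅ g 0 [ + 4 ] ⊎ g i ≅ g 1 [ + 4 ]
    two-cycle 0 = inj₁ (≅-refl (g 0))
    two-cycle 1 = inj₂ (≅-refl (g 1))
    two-cycle (suc (suc i)) with two-cycle i
    ... | inj₁ d = inj₁ (≅-trans (g (suc (suc i))) (g i) (g 0) (double-step i) d)
    ... | inj₂ d = inj₂ (≅-trans (g (suc (suc i))) (g i) (g 1) (double-step i) d)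
    hit : ∀ x → g 0 ≅ x [ + 4 ] ⊎ g 1 ≅ x [ + 4 ]
    hit x with surjective 0 x
    ... | i , d with two-cycle i
    ...   | inj₁ e = inj₁ (≅-trans (g 0) (g i) x (≅-sym (g i) (g 0) e) (∣-trans 4∣k d))
    ...   | inj₂ e = inj₂ (≅-trans (g 1) (g i) x (≅-sym (g i) (g 1) e) (∣-trans 4∣k d))
    small : ∀ {x} y z → y - z ≡ x → ¬ + 4 ∣ℤ x → ∀ w → w ≅ z [ + 4 ] → ¬ w ≅ y [ + 4 ]
    small y z refl 4∤x w d e = 4∤x (≅-trans y w z (≅-sym w y e) d)
    1-apart : ∀ x → x + + 2 - (x + 1ℤ) ≡ 1ℤ
    1-apart = solve-∀
    n-apart : ∀ n x → x + n - x ≡ n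
    n-apart = solve-∀
    4∤1 : ¬ + 4 ∣ℤ 1ℤ
    4∤1 = from-no (+ 4 ∣? 1ℤ)
    from-0 : ∀ n → ¬ + 4 ∣ℤ n → ¬ g 0 ≅ g 0 + n [ + 4 ]
    from-0 n 4∤n = small (g 0 + n) (g 0) (n-apart n (g 0)) 4∤n (g 0) (≅-refl (g 0))
    two-values : g 0 ≅ g 0 + 1ℤ [ + 4 ] ⊎ g 1 ≅ g 0 + 1ℤ [ + 4 ] →
                 g 0 ≅ g 0 + + 2 [ + 4 ] ⊎ g 1 ≅ g 0 + + 2 [ + 4 ] → ⊥
    two-values (inj₁ d) _        = from-0 1ℤ 4∤1 d
    two-values (inj₂ d) (inj₁ e) = from-0 (+ 2) (from-no (+ 4 ∣? + 2)) e
    two-values (inj₂ d) (inj₂ e) = small (g 0 + + 2) (g 0 + 1ℤ) (1-apart (g 0)) 4∤1 (g 1) d e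

  -- Differences of iterates are multiplied by `a` at each step. The orbits started at 0 and at 1
  -- have difference 1, and after `n` steps both are back.
  multiplier^period≅1 : ∀ n → (∀ i → g (i ℕ.+ n) ≅ g i [ k ]) → a ^ n ≅ 1ℤ [ k ]
  multiplier^period≅1 n periodic = ∣-resp (s (a ^ n) (g i₀) (g i₁) (g (i₀ ℕ.+ n)) (g (i₁ ℕ.+ n)))
    ((- 1ℤ *∣ difference n) ∣+ (periodic i₁ ∣+ ((- 1ℤ *∣ periodic i₀) ∣+
     (((1ℤ - a ^ n) *∣ proj₂ (surjective 0 1ℤ)) ∣+ ((a ^ n - 1ℤ) *∣ proj₂ (surjective 0 0ℤ))))))
    where
    i₀ = proj₁ (surjective 0 0ℤ)
    i₁ = proj₁ (surjective 0 1ℤ)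
    s : ∀ A x y x′ y′ → A - 1ℤ ≡ - 1ℤ * (y′ - x′ - A * (y - x)) + ((y′ - y) + (- 1ℤ * (x′ - x) +
      ((1ℤ - A) * (y - 1ℤ) + (A - 1ℤ) * (x - 0ℤ))))
    s = solve-∀
    difference : ∀ j → g (i₁ ℕ.+ j) - g (i₀ ℕ.+ j) ≅ a ^ j * (g i₁ - g i₀) [ k ]
    difference zero rewrite ℕₚ.+-identityʳ i₁ | ℕₚ.+-identityʳ i₀ = ≅-reflexive {i = g i₁ - g i₀} (sym (ℤₚ.*-identityˡ _))
    difference (suc j) rewrite ℕₚ.+-suc i₁ j | ℕₚ.+-suc i₀ j =
      ∣-resp (s′ a b (a ^ j) (g i₀) (g i₁) (g (i₀ ℕ.+ j)) (g (i₁ ℕ.+ j)) (g (suc (i₀ ℕ.+ j))) (g (suc (i₁ ℕ.+ j))))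
        (step (i₁ ℕ.+ j) ∣+ ((- 1ℤ *∣ step (i₀ ℕ.+ j)) ∣+ (a *∣ difference j)))
      where
      s′ : ∀ a b A x y x′ y′ x″ y″ → y″ - x″ - a * A * (y - x) ≡
        (y″ - (b + a * y′)) + (- 1ℤ * (x″ - (b + a * x′)) + a * (y′ - x′ - A * (y - x)))
      s′ = solve-∀

-- Integer coordinates on the cyclic group: arcs, translations and affine maps.

∣∧<⇒≡0 : ∀ {k i} → + k ∣ℤ i → ∣ i ∣ ℕ.< k → i ≡ 0ℤ
∣∧<⇒≡0 {suc k} {i} d lt with ∣ i ∣ in eq | Signed.∣⇒∣ᵤ d
... | zero  | _  = ℤₚ.∣i∣≡0⇒i≡0 eq
... | suc j | d′ = contradiction d′ (>⇒∤ lt)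

^-≅1 : ∀ {k} a M → a ≅ 1ℤ [ k ] → a ^ M ≅ 1ℤ [ k ]
^-≅1 a zero    d = ≅-refl 1ℤ
^-≅1 a (suc M) d = ∣-resp (s a (a ^ M)) (a *∣ ^-≅1 a M d ∣+ 1ℤ *∣ d)
  where
  s : ∀ a A → a * A - 1ℤ ≡ a * (A - 1ℤ) + 1ℤ * (a - 1ℤ)
  s = solve-∀

module Residues (m : ℕ) where

  N : ℤ
  N = + suc m

  infixl 6 _⊞_
  _⊞_ : Fin (suc m) → Fin (suc m) → Fin (suc m)
  _⊞_ = _⊕_ m

  opaque
    -- Kept opaque so that residue classes are compared through congruences and the remainder is not
    -- unfolded.
    [_] : ℤ → Fin (suc m)
    [ i ] = fromℕ< (n%ℕd<d i (suc m))

  ⟨_⟩ : Fin (suc m) → ℤ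
  ⟨ x ⟩ = + toℕ x

  opaque
    unfolding [_]

    ⟨[]⟩ : ∀ i → i ≅ ⟨ [ i ] ⟩ [ N ]
    ⟨[]⟩ i rewrite toℕ-fromℕ< (n%ℕd<d i (suc m)) = residue (suc m) i

    [⟨⟩] : ∀ x → [ ⟨ x ⟩ ] ≡ x
    [⟨⟩] x = toℕ-injective (trans (toℕ-fromℕ< _) (m<n⇒m%n≡m (toℕ<n x)))

    ⊞-⟨⟩ : ∀ x y → x ⊞ y ≡ [ ⟨ x ⟩ + ⟨ y ⟩ ]
    ⊞-⟨⟩ x y = refl

    zero≡[0] : Fin.zero ≡ [ 0ℤ ]
    zero≡[0] = refl

  opaque
    []-injective : ∀ {i j} → [ i ] ≡ [ j ] → i ≅ j [ N ]
    []-injective {i} {j} eq = ≅-trans i ⟨ [ i ] ⟩ j (⟨[]⟩ i)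
      (subst (λ x → ⟨ x ⟩ ≅ j [ N ]) (sym eq) (≅-sym j ⟨ [ j ] ⟩ (⟨[]⟩ j)))

    []-cong : ∀ {i j} → i ≅ j [ N ] → [ i ] ≡ [ j ]
    []-cong {i} {j} d = toℕ-injective (ℤₚ.+-injective (ℤₚ.i-j≡0⇒i≡j ⟨ [ i ] ⟩ ⟨ [ j ] ⟩ (∣∧<⇒≡0 d′ bound)))
      where
      d′ : ⟨ [ i ] ⟩ ≅ ⟨ [ j ] ⟩ [ N ]
      d′ = ≅-trans ⟨ [ i ] ⟩ i ⟨ [ j ] ⟩ (≅-sym i ⟨ [ i ] ⟩ (⟨[]⟩ i)) (≅-trans i j ⟨ [ j ] ⟩ d (⟨[]⟩ j))
      bound : ∣ ⟨ [ i ] ⟩ - ⟨ [ j ] ⟩ ∣ ℕ.< suc m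
      bound rewrite ℤₚ.m-n≡m⊖n (toℕ [ i ]) (toℕ [ j ]) =
        ℕₚ.≤-<-trans (ℤₚ.∣m⊝n∣≤m⊔n (toℕ [ i ]) (toℕ [ j ])) (ℕₚ.⊔-pres-<m (toℕ<n [ i ]) (toℕ<n [ j ]))

  lift : ∀ x → ∃ λ i → [ i ] ≡ x
  lift x = ⟨ x ⟩ , [⟨⟩] x

  opaque
    []-⊞ : ∀ i j → [ i ] ⊞ [ j ] ≡ [ i + j ]
    []-⊞ i j = trans (⊞-⟨⟩ [ i ] [ j ]) ([]-cong {⟨ [ i ] ⟩ + ⟨ [ j ] ⟩} {i + j}
      (∣-resp (s i j ⟨ [ i ] ⟩ ⟨ [ j ] ⟩) (- 1ℤ *∣ ⟨[]⟩ i ∣+ - 1ℤ *∣ ⟨[]⟩ j)))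
      where
      s : ∀ i j x y → x + y - (i + j) ≡ - 1ℤ * (i - x) + - 1ℤ * (j - y)
      s = solve-∀

    []-N : ∀ i → [ i + N ] ≡ [ i ]
    []-N i = []-cong {i + N} {i} (∣-resp (s i N) ∣-refl)
      where
      s : ∀ i n → i + n - i ≡ n
      s = solve-∀

    natural-lift : ∀ i → [ + (i %ℕ suc m) ] ≡ [ i ]
    natural-lift i = sym ([]-cong {i} (residue (suc m) i))

  translate : ℤ → Permutation′ (suc m)
  translate c = permutation (_⊞ [ c ]) (_⊞ [ - c ]) (cancel c (- c) (ℤₚ.+-inverseˡ c)) (cancel (- c) c (ℤₚ.+-inverseʳ c))
    where
    cancel : ∀ c d → d + c ≡ 0ℤ → ∀ x → x ⊞ [ d ] ⊞ [ c ] ≡ x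
    cancel c d eq x with lift x
    ... | i , refl = trans (cong (_⊞ [ c ]) ([]-⊞ i d)) (trans ([]-⊞ (i + d) c)
      (cong [_] (trans (ℤₚ.+-assoc i d c) (trans (cong (_+_ i) eq) (ℤₚ.+-identityʳ i)))))

  opaque
    -- Induction is possible only along natural numbers, so an integer is first replaced by its
    -- remainder.
    affine-from-step : (f : Fin (suc m) → Fin (suc m)) (a b : ℤ) → f [ 0ℤ ] ≡ [ b ] →
      (∀ i → f [ 1ℤ + i ] ≡ f [ i ] ⊞ [ a ]) → ∀ i → f [ i ] ≡ [ b + a * i ]
    affine-from-step f a b base step i = trans (cong f (sym (natural-lift i)))
      (trans (go (i %ℕ suc m)) ([]-cong {b + a * + (i %ℕ suc m)} (∣-resp (s a b i _) (- a *∣ residue (suc m) i))))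
      where
      s : ∀ a b i r → b + a * r - (b + a * i) ≡ - a * (i - r)
      s = solve-∀
      s₀ : ∀ a b → b ≡ b + a * 0ℤ
      s₀ = solve-∀
      s₁ : ∀ a b k → b + a * k + a ≡ b + a * (1ℤ + k)
      s₁ = solve-∀
      go : ∀ k → f [ + k ] ≡ [ b + a * + k ]
      go zero    = trans base (cong [_] (s₀ a b))
      go (suc k) = trans (step (+ k)) (trans (cong (_⊞ [ a ]) (go k))
        (trans ([]-⊞ (b + a * + k) a) (cong [_] (s₁ a b (+ k)))))

  module _ {S : Subset (suc m)} where

    opaque
      ∈-cong : ∀ {i j} → i ≅ j [ N ] → [ i ] ∈ S → [ j ] ∈ S
      ∈-cong {i} {j} d = subst (_∈ S) ([]-cong {i} {j} d)

      arc⁺ : ∀ i j → [ j - i ] ∈ S → Arc m S [ i ] [ j ]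
      arc⁺ i j s∈S = [ j - i ] , s∈S , sym (trans ([]-⊞ (j - i) i) (cong [_] (s i j)))
        where
        s : ∀ i j → j - i + i ≡ j
        s = solve-∀

      arc⁻ : ∀ i j → Arc m S [ i ] [ j ] → [ j - i ] ∈ S
      arc⁻ i j (x , x∈S , eq) with lift x
      ... | s , refl = ∈-cong {s} (∣-resp (sol s i j) (- 1ℤ *∣ []-injective {j} (trans eq ([]-⊞ s i)))) x∈S
        where
        sol : ∀ s i j → s - (j - i) ≡ - 1ℤ * (j - (s + i))
        sol = solve-∀

      arc-translate : ∀ c x y → Arc m S x y ⇔ Arc m S (x ⊞ [ c ]) (y ⊞ [ c ])
      arc-translate c x y with lift x | lift y
      ... | i , refl | j , refl rewrite []-⊞ i c | []-⊞ j c =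
        mk⇔ (λ a → arc⁺ (i + c) (j + c) (subst (_∈ S) (cong [_] (sym (s i j c))) (arc⁻ i j a)))
            (λ a → arc⁺ i j (subst (_∈ S) (cong [_] (s i j c)) (arc⁻ (i + c) (j + c) a)))
        where
        s : ∀ i j c → j + c - (i + c) ≡ j - i
        s = solve-∀

      -- Conjugating the generator, the translation by 1, into a translation by `a` means that σ has
      -- constant increment `a`.
      normal⇒affine : IsNormal m S → ∀ σ → IsDigraphAut m S σ → ∃₂ λ a b → ∀ i → σ ⟨$⟩ʳ [ i ] ≡ [ b + a * i ]
      normal⇒affine normal σ aut with normal σ aut [ 1ℤ ]
      ... | h , eq with lift h | lift (σ ⟨$⟩ʳ [ 0ℤ ])
      ...   | a , refl | b , σ0≡b = a , b , affine-from-step (σ ⟨$⟩ʳ_) a b (sym σ0≡b) step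
        where
        step : ∀ i → σ ⟨$⟩ʳ [ 1ℤ + i ] ≡ (σ ⟨$⟩ʳ [ i ]) ⊞ [ a ]
        step i = trans (cong (σ ⟨$⟩ʳ_) (trans (cong [_] (ℤₚ.+-comm 1ℤ i))
          (trans (sym ([]-⊞ i 1ℤ)) (cong (_⊞ [ 1ℤ ]) (sym (inverseˡ σ)))))) (eq (σ ⟨$⟩ʳ [ i ]))

      affine⇒normal : (∀ σ → IsDigraphAut m S σ → ∃₂ λ a b → ∀ i → σ ⟨$⟩ʳ [ i ] ≡ [ b + a * i ]) → IsNormal m S
      affine⇒normal affine σ aut g with affine σ aut | lift g
      ... | a , b , eq | j , refl = [ a * j ] , conj
        where
        s : ∀ a b i j → b + a * (i + j) ≡ b + a * i + a * j
        s = solve-∀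
        conj : ∀ x → σ ⟨$⟩ʳ ((σ ⟨$⟩ˡ x) ⊞ [ j ]) ≡ x ⊞ [ a * j ]
        conj x with lift (σ ⟨$⟩ˡ x)
        ... | i , [i]≡ = trans (cong (λ y → σ ⟨$⟩ʳ (y ⊞ [ j ])) (sym [i]≡)) (trans (cong (σ ⟨$⟩ʳ_) ([]-⊞ i j))
          (trans (eq (i + j)) (trans (cong [_] (s a b i j)) (trans (sym ([]-⊞ (b + a * i) (a * j)))
          (cong (_⊞ [ a * j ]) (trans (sym (eq i)) (trans (cong (σ ⟨$⟩ʳ_) [i]≡) (inverseʳ σ))))))))

      -- The arc from 0 to s goes to the arc from b to b + a s, where `b` cancels.
      affine-aut⇒closed : ∀ {σ a b} → IsDigraphAut m S σ → (∀ i → σ ⟨$⟩ʳ [ i ] ≡ [ b + a * i ]) →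
        ∀ s → [ s ] ∈ S → [ a * s ] ∈ S
      affine-aut⇒closed {σ} {a} {b} aut eq s s∈S =
        subst (_∈ S) (cong [_] (sol a b s)) (arc⁻ (b + a * 0ℤ) (b + a * s)
          (subst₂ (Arc m S) (eq 0ℤ) (eq s) (to (aut [ 0ℤ ] [ s ]) (arc⁺ 0ℤ s (subst (_∈ S) (cong [_] (sol₀ s)) s∈S)))))
        where
        sol : ∀ a b s → b + a * s - (b + a * 0ℤ) ≡ a * s
        sol = solve-∀
        sol₀ : ∀ s → s ≡ s - 0ℤ
        sol₀ = solve-∀

      closed-^ : ∀ {a} → (∀ s → [ s ] ∈ S → [ a * s ] ∈ S) → ∀ M s → [ s ] ∈ S → [ a ^ M * s ] ∈ S
      closed-^ {a} closed zero    s s∈S = subst (_∈ S) (cong [_] (sym (ℤₚ.*-identityˡ s))) s∈S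
      closed-^ {a} closed (suc M) s s∈S =
        subst (_∈ S) (cong [_] (sym (ℤₚ.*-assoc a (a ^ M) s))) (closed (a ^ M * s) (closed-^ closed M s s∈S))

  -- Translating by `b` before applying φ removes the constant term: the inverse of the composite is
  -- x ↦ c x, an additive bijection. The hypothesis concerns the inverse of φ because that is the
  -- map whose increments are computed below.
  affine-iso⇒group-aut : ∀ {S T b c} (φ : Permutation′ (suc m)) →
    (∀ x y → Arc m S x y ⇔ Arc m T (φ ⟨$⟩ʳ x) (φ ⟨$⟩ʳ y)) → (∀ i → φ ⟨$⟩ˡ [ i ] ≡ [ b + c * i ]) →
    ∃ λ σ → IsGroupAut m σ × _≡Image_under_ m T S σ
  affine-iso⇒group-aut {S} {T} {b} {c} φ iso eq = σ , additive , image
    where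
    σ = translate b ∘ₚ φ
    linear : ∀ i → σ ⟨$⟩ˡ [ i ] ≡ [ c * i ]
    linear i = trans (cong (_⊞ [ - b ]) (eq i)) (trans ([]-⊞ (b + c * i) (- b)) (cong [_] (s b (c * i))))
      where
      s : ∀ b x → b + x + - b ≡ x
      s = solve-∀
    additive : IsGroupAut m σ
    additive x y with lift (σ ⟨$⟩ʳ x) | lift (σ ⟨$⟩ʳ y)
    ... | i , [i]≡ | j , [j]≡ = trans (cong (σ ⟨$⟩ʳ_) (cong₂ _⊞_ (back x i [i]≡) (back y j [j]≡)))
      (trans (cong (σ ⟨$⟩ʳ_) (trans ([]-⊞ (c * i) (c * j))
        (trans (cong [_] (sym (ℤₚ.*-distribˡ-+ c i j))) (sym (linear (i + j))))))
      (trans (inverseʳ σ) (trans (sym ([]-⊞ i j)) (cong₂ _⊞_ [i]≡ [j]≡))))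
      where
      back : ∀ x i → [ i ] ≡ σ ⟨$⟩ʳ x → x ≡ [ c * i ]
      back x i e = trans (sym (inverseˡ σ)) (trans (cong (σ ⟨$⟩ˡ_) (sym e)) (linear i))
    -- [j] ∈ T iff 0 → [j] is an arc, iff its preimage [b] → [b + c j] is one.
    pull : ∀ j → [ j ] ∈ T → [ c * j ] ∈ S
    pull j j∈T = subst (_∈ S) (cong [_] (s b c j)) (arc⁻ (b + c * 0ℤ) (b + c * j)
      (subst₂ (Arc m S) (eq 0ℤ) (eq j) (from (iso _ _) (subst₂ (Arc m T) (sym (inverseʳ φ)) (sym (inverseʳ φ)) arc))))
      where
      s : ∀ b c j → b + c * j - (b + c * 0ℤ) ≡ c * j
      s = solve-∀
      arc : Arc m T [ 0ℤ ] [ j ]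
      arc = arc⁺ 0ℤ j (subst (_∈ T) (cong [_] (s₀ j)) j∈T)
        where
        s₀ : ∀ j → j ≡ j - 0ℤ
        s₀ = solve-∀
    push : ∀ j → [ c * j ] ∈ S → [ j ] ∈ T
    push j cj∈S = subst (_∈ T) (cong [_] (s₀ j)) (arc⁻ 0ℤ j
      (subst₂ (Arc m T) (trans (cong (φ ⟨$⟩ʳ_) (sym (eq 0ℤ))) (inverseʳ φ))
                        (trans (cong (φ ⟨$⟩ʳ_) (sym (eq j))) (inverseʳ φ))
        (to (iso _ _) (arc⁺ (b + c * 0ℤ) (b + c * j) (subst (_∈ S) (cong [_] (s b c j)) cj∈S)))))
      where
      s : ∀ b c j → c * j ≡ b + c * j - (b + c * 0ℤ)
      s = solve-∀
      s₀ : ∀ j → j - 0ℤ ≡ j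
      s₀ = solve-∀
    image : _≡Image_under_ m T S σ
    image t with lift t
    ... | j , refl = mk⇔
      (λ t∈T → σ ⟨$⟩ˡ [ j ] , subst (_∈ S) (sym (linear j)) (pull j t∈T) , inverseʳ σ)
      (λ { (s , s∈S , σs≡t) → push j (subst (_∈ S)
        (trans (sym (inverseˡ σ)) (trans (cong (σ ⟨$⟩ˡ_) σs≡t) (linear j))) s∈S) })

-- Moving the multiples of a divisor of n and fixing all other residues.

module Shift (m : ℕ) {r : ℤ} (r∣n : r ∣ℤ + suc m) where

  open Residues m

  -- Testing the representative is legitimate because r ∣ n makes the answer the same for all
  -- integers in the class.
  shift : ℤ → Fin (suc m) → Fin (suc m)
  shift u x with r ∣? ⟨ x ⟩
  ... | yes _ = [ ⟨ x ⟩ + u ]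
  ... | no  _ = x

  opaque
    r∣-lift : ∀ i → r ∣ℤ i → r ∣ℤ ⟨ [ i ] ⟩
    r∣-lift i r∣i = ∣-resp (s i ⟨ [ i ] ⟩) (r∣i ∣+ - 1ℤ *∣ ∣-trans r∣n (⟨[]⟩ i))
      where
      s : ∀ i x → x ≡ i + - 1ℤ * (i - x)
      s = solve-∀

    r∣-lower : ∀ i → r ∣ℤ ⟨ [ i ] ⟩ → r ∣ℤ i
    r∣-lower i r∣x = ∣-resp (s i ⟨ [ i ] ⟩) (r∣x ∣+ ∣-trans r∣n (⟨[]⟩ i))
      where
      s : ∀ i x → i ≡ x + (i - x)
      s = solve-∀

    shift-yes : ∀ u i → r ∣ℤ i → shift u [ i ] ≡ [ i + u ]
    shift-yes u i r∣i with r ∣? ⟨ [ i ] ⟩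
    ... | yes _ = []-cong {⟨ [ i ] ⟩ + u} (∣-resp (s i ⟨ [ i ] ⟩ u) (- 1ℤ *∣ ⟨[]⟩ i))
      where
      s : ∀ i x u → x + u - (i + u) ≡ - 1ℤ * (i - x)
      s = solve-∀
    ... | no r∤x = contradiction (r∣-lift i r∣i) r∤x

    shift-no : ∀ u i → ¬ r ∣ℤ i → shift u [ i ] ≡ [ i ]
    shift-no u i r∤i with r ∣? ⟨ [ i ] ⟩
    ... | yes r∣x = contradiction (r∣-lower i r∣x) r∤i
    ... | no _    = refl

    shift-cancel : ∀ u v → v + u ≡ 0ℤ → r ∣ℤ v → ∀ x → shift u (shift v x) ≡ x
    shift-cancel u v v+u≡0 r∣v x = go (lift x)
      where
      go : (∃ λ i → [ i ] ≡ x) → shift u (shift v x) ≡ x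
      go (i , refl) with r ∣? i
      ... | yes r∣i = trans (cong (shift u) (shift-yes v i r∣i)) (trans (shift-yes u (i + v) (r∣i ∣+ r∣v))
        (cong [_] (trans (ℤₚ.+-assoc i v u) (trans (cong (_+_ i) v+u≡0) (ℤₚ.+-identityʳ i)))))
      ... | no r∤i = trans (cong (shift u) (shift-no v i r∤i)) (shift-no u i r∤i)

    r∣- : ∀ {u} → r ∣ℤ u → r ∣ℤ - u
    r∣- {u} r∣u = ∣-resp (s u) (- 1ℤ *∣ r∣u)
      where
      s : ∀ u → - u ≡ - 1ℤ * u
      s = solve-∀

  shiftₚ : ∀ u → r ∣ℤ u → Permutation′ (suc m)
  shiftₚ u r∣u = permutation (shift u) (shift (- u))
    (shift-cancel u (- u) (ℤₚ.+-inverseˡ u) (r∣- r∣u)) (shift-cancel (- u) u (ℤₚ.+-inverseʳ u) r∣u)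

  -- For r ∣ u this makes the part of `S` outside the multiples of `r` a union of cosets of the
  -- subgroup generated by `u`.
  Invariant : Subset (suc m) → ℤ → Set
  Invariant S u = ∀ s → ¬ r ∣ℤ s → [ s ] ∈ S → [ s + u ] ∈ S

  module _ {S : Subset (suc m)} where

    opaque
      invariant-* : ∀ {u} → r ∣ℤ u → Invariant S u → ∀ k → Invariant S (+ k * u)
      invariant-* {u} r∣u inv zero    s r∤s s∈S = subst (_∈ S) (cong [_] (sym (ℤₚ.+-identityʳ s))) s∈S
      invariant-* {u} r∣u inv (suc k) s r∤s s∈S =
        subst (_∈ S) (cong [_] (eq s (+ k) u)) (inv (s + + k * u) r∤s+ku (invariant-* r∣u inv k s r∤s s∈S))
        where
        eq : ∀ s k u → s + k * u + u ≡ s + (1ℤ + k) * u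
        eq = solve-∀
        eq₂ : ∀ s x → s ≡ s + x + - 1ℤ * x
        eq₂ = solve-∀
        r∤s+ku : ¬ r ∣ℤ s + + k * u
        r∤s+ku d = r∤s (∣-resp (eq₂ s (+ k * u)) (d ∣+ - 1ℤ *∣ (+ k *∣ r∣u)))

      invariant-neg : ∀ {u} → r ∣ℤ u → Invariant S u → Invariant S (- u)
      invariant-neg {u} r∣u inv s r∤s s∈S =
        -- As n = m + 1, subtracting `u` is the same as adding it `m` times.
        ∈-cong {S} {s + + m * u} (∣-resp (eq s (+ m) u) (u *∣ ∣-refl)) (invariant-* r∣u inv m s r∤s s∈S)
        where
        eq : ∀ s m u → s + m * u - (s + - u) ≡ u * (1ℤ + m)
        eq = solve-∀

      -- If both ends move, or neither does, their difference is unchanged. If exactly one moves,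
      -- the difference is not a multiple of `r` and changes by u or - u, which the invariance
      -- absorbs.
      shift-arc : ∀ {u} → r ∣ℤ u → Invariant S u → ∀ x y → Arc m S x y → Arc m S (shift u x) (shift u y)
      shift-arc {u} r∣u inv x y = go (lift x) (lift y)
        where
        r∤-diffˡ : ∀ i j → r ∣ℤ i → ¬ r ∣ℤ j → ¬ r ∣ℤ j - i
        r∤-diffˡ i j r∣i r∤j d = r∤j (∣-resp (eq i j) (d ∣+ r∣i))
          where
          eq : ∀ i j → j ≡ (j - i) + i
          eq = solve-∀
        r∤-diffʳ : ∀ i j → ¬ r ∣ℤ i → r ∣ℤ j → ¬ r ∣ℤ j - i
        r∤-diffʳ i j r∤i r∣j d = r∤i (∣-resp (eq i j) (r∣j ∣+ - 1ℤ *∣ d))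
          where
          eq : ∀ i j → i ≡ j + - 1ℤ * (j - i)
          eq = solve-∀
        arc : ∀ i j {x y} → x ≡ [ i ] → y ≡ [ j ] → [ j - i ] ∈ S → Arc m S x y
        arc i j refl refl = arc⁺ i j
        eq₁ : ∀ i j u → j - i ≡ (j + u) - (i + u)
        eq₁ = solve-∀
        eq₂ : ∀ i j u → (j - i) + - u ≡ j - (i + u)
        eq₂ = solve-∀
        eq₃ : ∀ i j u → (j - i) + u ≡ (j + u) - i
        eq₃ = solve-∀
        go : (∃ λ i → [ i ] ≡ x) → (∃ λ j → [ j ] ≡ y) → Arc m S x y → Arc m S (shift u x) (shift u y)
        go (i , refl) (j , refl) a with r ∣? i | r ∣? j
        ... | yes p | yes q = arc (i + u) (j + u) (shift-yes u i p) (shift-yes u j q)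
          (subst (_∈ S) (cong [_] (eq₁ i j u)) (arc⁻ i j a))
        ... | yes p | no ¬q = arc (i + u) j (shift-yes u i p) (shift-no u j ¬q)
          (subst (_∈ S) (cong [_] (eq₂ i j u)) (invariant-neg r∣u inv (j - i) (r∤-diffˡ i j p ¬q) (arc⁻ i j a)))
        ... | no ¬p | yes q = arc i (j + u) (shift-no u i ¬p) (shift-yes u j q)
          (subst (_∈ S) (cong [_] (eq₃ i j u)) (inv (j - i) (r∤-diffʳ i j ¬p q) (arc⁻ i j a)))
        ... | no ¬p | no ¬q = arc i j (shift-no u i ¬p) (shift-no u j ¬q) (arc⁻ i j a)

      shift-aut : ∀ {u} (r∣u : r ∣ℤ u) → Invariant S u → IsDigraphAut m S (shiftₚ u r∣u)
      shift-aut {u} r∣u inv x y = mk⇔ (shift-arc r∣u inv x y)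
        (λ a → subst₂ (Arc m S) (inverseˡ (shiftₚ u r∣u)) (inverseˡ (shiftₚ u r∣u))
          (shift-arc (r∣- r∣u) (invariant-neg r∣u inv) (shift u x) (shift u y) a))

      -- The shift fixes 1 and moves 0 by u, so it is affine only if it moves 2 by - u.
      normal⇒double-shift≅0 : ¬ r ∣ℤ 1ℤ → ∀ {u} → r ∣ℤ u → Invariant S u → IsNormal m S → N ∣ℤ u + u
      normal⇒double-shift≅0 r∤1 {u} r∣u inv normal = go (normal⇒affine normal (shiftₚ u r∣u) (shift-aut r∣u inv))
        where
        go : (∃₂ λ a b → ∀ i → shift u [ i ] ≡ [ b + a * i ]) → N ∣ℤ u + u
        go (a , b , eq) with r ∣? + 2
        ... | yes p = ∣-resp (s u a b) (at-2 ∣+ ((- + 2) *∣ at-1 ∣+ at-0))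
          where
          at-0 : 0ℤ + u ≅ b + a * 0ℤ [ N ]
          at-0 = []-injective (trans (sym (shift-yes u 0ℤ (divides 0ℤ refl))) (eq 0ℤ))
          at-1 : 1ℤ ≅ b + a * 1ℤ [ N ]
          at-1 = []-injective (trans (sym (shift-no u 1ℤ r∤1)) (eq 1ℤ))
          at-2 : + 2 + u ≅ b + a * + 2 [ N ]
          at-2 = []-injective (trans (sym (shift-yes u (+ 2) p)) (eq (+ 2)))
          s : ∀ u a b → u + u ≡ (+ 2 + u - (b + a * + 2)) + (- + 2 * (1ℤ - (b + a * 1ℤ)) + (0ℤ + u - (b + a * 0ℤ)))
          s = solve-∀
        -- Now 2 is fixed, which even gives u ≡ 0; the congruences are doubled so that both cases
        -- end in u + u ≡ 0.
        ... | no ¬p = ∣-resp (s u a b) (+ 2 *∣ at-2 ∣+ ((- + 4) *∣ at-1 ∣+ + 2 *∣ at-0))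
          where
          at-0 : 0ℤ + u ≅ b + a * 0ℤ [ N ]
          at-0 = []-injective (trans (sym (shift-yes u 0ℤ (divides 0ℤ refl))) (eq 0ℤ))
          at-1 : 1ℤ ≅ b + a * 1ℤ [ N ]
          at-1 = []-injective (trans (sym (shift-no u 1ℤ r∤1)) (eq 1ℤ))
          at-2 : + 2 ≅ b + a * + 2 [ N ]
          at-2 = []-injective (trans (sym (shift-no u (+ 2) ¬p)) (eq (+ 2)))
          s : ∀ u a b → u + u ≡ + 2 * (+ 2 - (b + a * + 2)) + (- + 4 * (1ℤ - (b + a * 1ℤ)) + + 2 * (0ℤ + u - (b + a * 0ℤ)))
          s = solve-∀

-- The translation by 1 pulled back along an isomorphism.

module Conjugation (m : ℕ) {S T : Subset (suc m)} (φ : Permutation′ (suc m))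
  (iso : ∀ x y → Arc m S x y ⇔ Arc m T (φ ⟨$⟩ʳ x) (φ ⟨$⟩ʳ y)) where

  open Residues m

  conjugate : Permutation′ (suc m)
  conjugate = φ ∘ₚ (translate 1ℤ ∘ₚ flip φ)

  opaque
    conjugate-aut : IsDigraphAut m S conjugate
    conjugate-aut x y = mk⇔
      (λ a → from (iso cx cy) (subst₂ (Arc m T) (sym (inverseʳ φ)) (sym (inverseʳ φ)) (to translated (to (iso x y) a))))
      (λ a → from (iso x y) (from translated (subst₂ (Arc m T) (inverseʳ φ) (inverseʳ φ) (to (iso cx cy) a))))
      where
      cx cy : Fin (suc m)
      cx = conjugate ⟨$⟩ʳ x
      cy = conjugate ⟨$⟩ʳ y
      translated : Arc m T (φ ⟨$⟩ʳ x) (φ ⟨$⟩ʳ y) ⇔ Arc m T ((φ ⟨$⟩ʳ x) ⊞ [ 1ℤ ]) ((φ ⟨$⟩ʳ y) ⊞ [ 1ℤ ])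
      translated = arc-translate {T} 1ℤ (φ ⟨$⟩ʳ x) (φ ⟨$⟩ʳ y)

  module _ {a b} (affine : ∀ i → conjugate ⟨$⟩ʳ [ i ] ≡ [ b + a * i ]) where

    -- The preimages of 0, 1, 2, ... under φ form an orbit of `conjugate`, which takes the preimage
    -- of k to that of k + 1.
    iterates : ℕ → ℤ
    iterates k = ⟨ φ ⟨$⟩ˡ [ + k ] ⟩

    opaque
      successor : ∀ i → φ ⟨$⟩ˡ [ 1ℤ + i ] ≡ conjugate ⟨$⟩ʳ (φ ⟨$⟩ˡ [ i ])
      successor i = cong (φ ⟨$⟩ˡ_) (trans (cong [_] (ℤₚ.+-comm 1ℤ i)) (trans (sym ([]-⊞ i 1ℤ)) (cong (_⊞ [ 1ℤ ]) (sym (inverseʳ φ)))))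

      iterates-step : ∀ k → iterates (suc k) ≅ b + a * iterates k [ N ]
      iterates-step k = []-injective (trans ([⟨⟩] (φ ⟨$⟩ˡ [ + suc k ])) (trans (successor (+ k))
        (trans (cong (conjugate ⟨$⟩ʳ_) (sym ([⟨⟩] (φ ⟨$⟩ˡ [ + k ])))) (affine (iterates k)))))

      iterates-surjective : ∀ K x → ∃ λ k → iterates (K ℕ.+ k) ≅ x [ N ]
      iterates-surjective K x = k , []-injective (trans ([⟨⟩] _)
        (trans (cong (φ ⟨$⟩ˡ_) ([]-cong {+ (K ℕ.+ k)} {y} k-hits)) (trans (cong (φ ⟨$⟩ˡ_) ([⟨⟩] _)) (inverseˡ φ))))
        where
        y : ℤ
        y = ⟨ φ ⟨$⟩ʳ [ x ] ⟩
        k : ℕ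
        -- K + k has to be congruent to the image of `x`; the remainder makes the difference a
        -- natural number.
        k = (y - + K) %ℕ suc m
        s : ∀ K k y → K + k - y ≡ - 1ℤ * (y - K - k)
        s = solve-∀
        k-hits : + (K ℕ.+ k) ≅ y [ N ]
        k-hits = subst (λ z → z ≅ y [ N ]) (sym (ℤₚ.pos-+ K k)) (∣-resp (s (+ K) (+ k) y) (- 1ℤ *∣ residue (suc m) (y - + K)))

      iterates-periodic : ∀ k → iterates (k ℕ.+ suc m) ≅ iterates k [ N ]
      iterates-periodic k = ≅-reflexive {i = iterates (k ℕ.+ suc m)} (cong (λ z → ⟨ φ ⟨$⟩ˡ z ⟩)
        (trans (cong [_] (ℤₚ.pos-+ k (suc m))) ([]-N (+ k))))

    opaque
      multiplier≅1-mod-prime : ∀ p → Prime p → + p ∣ℤ N → a ≅ 1ℤ [ + p ]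
      multiplier≅1-mod-prime = AffineCycle.multiplier≅1-mod-prime N a b iterates iterates-step iterates-surjective

      multiplier≅1-mod-4 : + 4 ∣ℤ N → a ≅ 1ℤ [ + 4 ]
      multiplier≅1-mod-4 = AffineCycle.multiplier≅1-mod-4 N a b iterates iterates-step iterates-surjective

      multiplier^n≅1 : a ^ suc m ≅ 1ℤ [ N ]
      multiplier^n≅1 = AffineCycle.multiplier^period≅1 N a b iterates iterates-step iterates-surjective (suc m) iterates-periodic

      -- Now `conjugate` is the translation by `b`, so the inverse of φ has constant increment `b`
      -- and is therefore affine.
      multiplier≅1⇒group-aut : a ≅ 1ℤ [ N ] → ∃ λ σ → IsGroupAut m σ × _≡Image_under_ m T S σ
      multiplier≅1⇒group-aut a≅1 = affine-iso⇒group-aut {S} {T} {iterates 0} {b} φ iso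
        (affine-from-step (φ ⟨$⟩ˡ_) b (iterates 0) (sym ([⟨⟩] _)) step)
        where
        s : ∀ a b x → b + a * x - (x + b) ≡ x * (a - 1ℤ)
        s = solve-∀
        step : ∀ i → φ ⟨$⟩ˡ [ 1ℤ + i ] ≡ (φ ⟨$⟩ˡ [ i ]) ⊞ [ b ]
        step i = trans (successor i) (go (lift (φ ⟨$⟩ˡ [ i ])))
          where
          go : ∀ {y} → (∃ λ j → [ j ] ≡ y) → conjugate ⟨$⟩ʳ y ≡ y ⊞ [ b ]
          go (j , refl) = trans (affine j) (trans ([]-cong {b + a * j} {j + b} (∣-resp (s a b j) (j *∣ a≅1))) (sym ([]-⊞ j b)))

-- Triviality of the multipliers of normal Cayley digraphs.

module Multipliers (m : ℕ) {S : Subset (suc m)} (normal : IsNormal m S) where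

  open Residues m

  -- This is what is retained of the pulled-back translation: `closed` because it is an
  -- automorphism, the other fields because it is an n-cycle.
  record CycleMultiplier (a : ℤ) : Set where
    field
      closed      : ∀ s → [ s ] ∈ S → [ a * s ] ∈ S
      ≅1-mod-prime : ∀ p → Prime p → + p ∣ℤ N → a ≅ 1ℤ [ + p ]
      ≅1-mod-4    : + 4 ∣ℤ N → a ≅ 1ℤ [ + 4 ]
      ^n≅1        : a ^ suc m ≅ 1ℤ [ N ]

  opaque
    trivial-multipliers⇒CI : (∀ a → CycleMultiplier a → a ≅ 1ℤ [ N ]) → IsCI m S
    trivial-multipliers⇒CI trivial T (φ , iso) = go (normal⇒affine normal conjugate conjugate-aut)
      where
      open Conjugation m {S} {T} φ iso
      go : (∃₂ λ a b → ∀ i → conjugate ⟨$⟩ʳ [ i ] ≡ [ b + a * i ]) → ∃ λ σ → IsGroupAut m σ × _≡Image_under_ m T S σ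
      go (a , b , affine) = multiplier≅1⇒group-aut {a} {b} affine (trivial a (record
        { closed       = affine-aut⇒closed {S} {conjugate} {a} {b} conjugate-aut affine
        ; ≅1-mod-prime = multiplier≅1-mod-prime {a} {b} affine
        ; ≅1-mod-4     = multiplier≅1-mod-4 {a} {b} affine
        ; ^n≅1         = multiplier^n≅1 {a} {b} affine
        }))

    -- Since t² ≡ 0 modulo N, the powers of 1 + t are the 1 + k t, and k s ≡ 1 modulo r is solvable.
    root-of-unity⇒invariant : ∀ {r t} → Prime r → + r ∣ℤ t → N ∣ℤ t * + r → (r∣N : + r ∣ℤ N) →
      (∀ s → [ s ] ∈ S → [ (1ℤ + t) * s ] ∈ S) → Shift.Invariant m r∣N S t
    root-of-unity⇒invariant {r} {t} pr (divides t′ t≡t′r) N∣tr r∣N closed s r∤s s∈S =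
      go (inverse-mod-prime s pr r∤s)
      where
      instance
        r≢0 : ℕ.NonZero r
        r≢0 = prime⇒nonZero pr
      N∣t² : N ∣ℤ t * t
      N∣t² = ∣-resp (trans (cong (t *_) t≡t′r) (sol t t′ (+ r))) (t′ *∣ N∣tr)
        where
        sol : ∀ t t′ r → t * (t′ * r) ≡ t′ * (t * r)
        sol = solve-∀
      go : (∃ λ c → s * c ≅ 1ℤ [ + r ]) → [ s + t ] ∈ S
      go (c , sc≅1) = ∈-cong {S} {(1ℤ + t) ^ k * s} (expand (binomial-expansion t k)) (closed-^ {S} closed k s s∈S)
        where
        k : ℕ
        k = c %ℕ r
        sk≅1 : s * + k ≅ 1ℤ [ + r ]
        sk≅1 = ∣-resp (sol s c (+ k)) (sc≅1 ∣+ (- s) *∣ residue r c)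
          where
          sol : ∀ s c k → s * k - 1ℤ ≡ (s * c - 1ℤ) + - s * (c - k)
          sol = solve-∀
        N∣t[sk-1] : N ∣ℤ t * (s * + k - 1ℤ)
        N∣t[sk-1] = absorb sk≅1
          where
          sol : ∀ t q r → t * (q * r) ≡ q * (t * r)
          sol = solve-∀
          absorb : + r ∣ℤ s * + k - 1ℤ → N ∣ℤ t * (s * + k - 1ℤ)
          absorb (divides q e) = ∣-resp (trans (cong (t *_) e) (sol t q (+ r))) (q *∣ N∣tr)
        expand : (∃₂ λ c w → (1ℤ + t) ^ k ≡ 1ℤ + + k * t + c * (t * t) + t * t * t * w × c + c ≡ + k * (+ k - 1ℤ)) →
          (1ℤ + t) ^ k * s ≅ s + t [ N ]
        expand (c , w , e , _) = ∣-resp (trans (cong (λ z → z * s - (s + t)) e) (sol s t (+ k) c w))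
          (N∣t[sk-1] ∣+ (s * (c + t * w)) *∣ N∣t²)
          where
          sol : ∀ s t k c w → (1ℤ + k * t + c * (t * t) + t * t * t * w) * s - (s + t) ≡
            t * (s * k - 1ℤ) + s * (c + t * w) * (t * t)
          sol = solve-∀

    -- The shift by `t` is an automorphism, so normality forces 2 t ≡ 0. Together with r t ≡ 0 for
    -- odd `r` this leaves t ≡ 0.
    odd-root⇒trivial : ∀ {r t} → Prime r → r ≢ 2 → + r ∣ℤ N →
      (∀ p → Prime p → + p ∣ℤ N → + p ∣ℤ t) → (1ℤ + t) ^ r ≅ 1ℤ [ N ] →
      (∀ s → [ s ] ∈ S → [ (1ℤ + t) * s ] ∈ S) → N ∣ℤ t
    odd-root⇒trivial {r} {t} pr r≢2 r∣N p∣t t^r closed = go (parity (+ r))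
      where
      N∣tr : N ∣ℤ t * + r
      N∣tr = root-of-unity-odd pr r≢2 r∣N p∣t t^r
      r∣t : + r ∣ℤ t
      r∣t = p∣t r pr r∣N
      N∣t+t : N ∣ℤ t + t
      N∣t+t = Shift.normal⇒double-shift≅0 m r∣N {S} (prime∤1 pr) r∣t
        (root-of-unity⇒invariant pr r∣t N∣tr r∣N closed) normal
      go : (∃ λ j → + r ≡ j + j ⊎ + r ≡ j + j + 1ℤ) → N ∣ℤ t
      go (j , inj₁ r≡2j) = contradiction (sym (prime∣⇒≡ prime[2] pr (Signed.∣⇒∣ᵤ (divides j (trans r≡2j (sol j)))))) r≢2
        where
        sol : ∀ j → j + j ≡ j * + 2
        sol = solve-∀
      go (j , inj₂ r≡2j+1) = ∣-resp (trans (sol t j) (cong (λ z → t * z + - j * (t + t)) (sym r≡2j+1))) (N∣tr ∣+ (- j) *∣ N∣t+t)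
        where
        sol : ∀ t j → t ≡ t * (j + j + 1ℤ) + - j * (t + t)
        sol = solve-∀

    -- A nontrivial `a` would have a nontrivial power of prime order `r`. For r = 2 arithmetic alone
    -- excludes it, for odd `r` normality does.
    8∤n⇒multiplier≅1 : ¬ + 8 ∣ℤ N → ∀ a → CycleMultiplier a → a ≅ 1ℤ [ N ]
    8∤n⇒multiplier≅1 8∤N a mult = decide (N ∣? (a - 1ℤ))
      where
      open CycleMultiplier mult
      trivial-power : ∀ r M → Prime r → + r ∣ℤ N → (a ^ M) ^ r ≅ 1ℤ [ N ] → a ^ M ≅ 1ℤ [ N ]
      trivial-power r M pr r∣N root = go (r ℕ.≟ 2)
        where
        t : ℤ
        t = a ^ M - 1ℤ
        1+t≡ : 1ℤ + t ≡ a ^ M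
        1+t≡ = sol (a ^ M)
          where
          sol : ∀ x → 1ℤ + (x - 1ℤ) ≡ x
          sol = solve-∀
        root′ : (1ℤ + t) ^ r ≅ 1ℤ [ N ]
        root′ = subst (λ z → z ^ r ≅ 1ℤ [ N ]) (sym 1+t≡) root
        p∣t : ∀ p → Prime p → + p ∣ℤ N → + p ∣ℤ t
        p∣t p pp p∣N = ^-≅1 a M (≅1-mod-prime p pp p∣N)
        4∣t : + 4 ∣ℤ N → + 4 ∣ℤ t
        4∣t 4∣N = ^-≅1 a M (≅1-mod-4 4∣N)
        go : Dec (r ≡ 2) → N ∣ℤ t
        go (yes refl) = root-of-unity-two 8∤N r∣N p∣t 4∣t root′
        go (no r≢2)   = odd-root⇒trivial pr r≢2 r∣N p∣t root′
          (λ s s∈S → subst (λ z → [ z * s ] ∈ S) (sym 1+t≡) (closed-^ {S} closed M s s∈S))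
      decide : Dec (a ≅ 1ℤ [ N ]) → a ≅ 1ℤ [ N ]
      decide (yes a≅1) = a≅1
      decide (no a≇1)  = go (primeOrderPower (suc m) ^n≅1 a≇1)
        where
        go : (∃₂ λ r M → Prime r × r ∣ suc m × ¬ (a ^ M ≅ 1ℤ [ N ]) × (a ^ M) ^ r ≅ 1ℤ [ N ]) → a ≅ 1ℤ [ N ]
        go (r , M , pr , r∣n , ≇1 , root) = contradiction (trivial-power r M pr (Signed.∣ᵤ⇒∣ r∣n) root) ≇1

8∤n⇒NDCI : ∀ m → ¬ 8 ∣ suc m → NDCI m
8∤n⇒NDCI m 8∤n S _ normal = trivial-multipliers⇒CI (8∤n⇒multiplier≅1 (λ d → 8∤n (Signed.∣⇒∣ᵤ d)))
  where open Multipliers m normal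

-- A multiplier a ≡ 5 together with -1 makes the odd part of S invariant under the shift by 2.
NCI-8 : NCI 7
NCI-8 S _ symmetric normal = trivial-multipliers⇒CI multiplier≅1
  where
  open Residues 7
  open Multipliers 7 normal
  module _ (a : ℤ) (mult : CycleMultiplier a) where
    open CycleMultiplier mult
    neg : ∀ s → [ s ] ∈ S → [ - s ] ∈ S
    neg s = symmetric [ s ] [ - s ] (trans ([]-⊞ (- s) s) (trans (cong [_] (ℤₚ.+-inverseˡ s)) (sym zero≡[0])))
    2∣N : + 2 ∣ℤ N
    2∣N = divides (+ 4) refl
    odd-invariant : ∀ e → a ≡ + 5 + e * + 8 → Shift.Invariant 7 2∣N S (+ 2)
    odd-invariant e a≡ s 2∤s s∈S = go (parity s)
      where
      go : (∃ λ j → s ≡ j + j ⊎ s ≡ j + j + 1ℤ) → [ s + + 2 ] ∈ S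
      go (j , inj₁ s≡2j) = contradiction (divides j (trans s≡2j (sol j))) 2∤s
        where
        sol : ∀ j → j + j ≡ j * + 2
        sol = solve-∀
      go (j , inj₂ s≡2j+1) = go′ (parity j)
        where
        go′ : (∃ λ l → j ≡ l + l ⊎ j ≡ l + l + 1ℤ) → [ s + + 2 ] ∈ S
        -- For s ≡ 1 modulo 4 one has - 5 s ≡ s + 2 modulo 8; for s ≡ 3 modulo 4 already - s ≡ s +
        -- 2.
        go′ (l , inj₁ j≡2l) = ∈-cong {S} {a * - s} (divides (- (1ℤ + + 3 * l + e * (+ 4 * l + 1ℤ)))
          (trans (cong₂ (λ a s → a * - s - (s + + 2)) a≡ (trans s≡2j+1 (cong (λ j → j + j + 1ℤ) j≡2l))) (sol e l)))
          (closed (- s) (neg s s∈S))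
          where
          sol : ∀ e l → (+ 5 + e * + 8) * - (l + l + (l + l) + 1ℤ) - (l + l + (l + l) + 1ℤ + + 2) ≡
            - (1ℤ + + 3 * l + e * (+ 4 * l + 1ℤ)) * + 8
          sol = solve-∀
        go′ (l , inj₂ j≡2l+1) = ∈-cong {S} { - s} (divides (- (l + 1ℤ))
          (trans (cong (λ s → - s - (s + + 2)) (trans s≡2j+1 (cong (λ j → j + j + 1ℤ) j≡2l+1))) (sol l))) (neg s s∈S)
          where
          sol : ∀ l → - (l + l + 1ℤ + (l + l + 1ℤ) + 1ℤ) - (l + l + 1ℤ + (l + l + 1ℤ) + 1ℤ + + 2) ≡ - (l + 1ℤ) * + 8
          sol = solve-∀
    multiplier≅1 : a ≅ 1ℤ [ N ]
    multiplier≅1 = go (≅1-mod-4 (divides (+ 2) refl))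
      where
      go : a ≅ 1ℤ [ + 4 ] → a ≅ 1ℤ [ N ]
      go (divides q a-1≡4q) = go′ (parity q)
        where
        go′ : (∃ λ e → q ≡ e + e ⊎ q ≡ e + e + 1ℤ) → a ≅ 1ℤ [ N ]
        go′ (e , inj₁ q≡2e) = divides e (trans a-1≡4q (trans (cong (_* + 4) q≡2e) (sol e)))
          where
          sol : ∀ e → (e + e) * + 4 ≡ e * + 8
          sol = solve-∀
        -- This is the case a ≡ 5, where the shift by 2 would be an automorphism and normality would
        -- give 8 ∣ 4.
        go′ (e , inj₂ q≡2e+1) = contradiction
          (Shift.normal⇒double-shift≅0 7 2∣N {S} (prime∤1 prime[2]) {+ 2} ∣-refl
            (odd-invariant e (trans (sol₁ a) (trans (cong (_+ 1ℤ) (trans a-1≡4q (cong (_* + 4) q≡2e+1))) (sol₂ e)))) normal)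
          (from-no (+ 8 ∣? + 4))
          where
          sol₁ : ∀ a → a ≡ a - 1ℤ + 1ℤ
          sol₁ = solve-∀
          sol₂ : ∀ e → (e + e + 1ℤ) * + 4 + 1ℤ ≡ + 5 + e * + 8
          sol₂ = solve-∀

-- Symbolic connection sets for n divisible by 8.

-- (i , e) stands for the residue i + e h, where n = 2 h.
Symbol : Set
Symbol = ℤ × ℤ

infixl 6 _⊹_ _∸_
_⊹_ _∸_ : Symbol → Symbol → Symbol
(i , e) ⊹ (j , f) = i + j , e + f
(i , e) ∸ (j , f) = i - j , e - f

negate : Symbol → Symbol
negate (i , e) = - i , - e

-- The test does not mention n, so conditions on concrete lists are decided by evaluation, once for
-- all n. It agrees with being 0 modulo n as long as the first component is smaller than h in
-- absolute value.
Null : Symbol → Set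
Null (i , e) = i ≡ 0ℤ × + 2 ∣ℤ e

Null? : Decidable Null
Null? (i , e) = (i ℤ.≟ 0ℤ) ×-dec (+ 2 ∣? e)

Small : ℕ → Symbol → Set
Small B (i , e) = ∣ i ∣ ℕ.< B

Small? : ∀ B → Decidable (Small B)
Small? B (i , e) = ∣ i ∣ ℕ.<? B

infix 4 _∈ₛ_ _∈ₛ?_
_∈ₛ_ : Symbol → List Symbol → Set
x ∈ₛ L = Any (λ y → Null (x ∸ y)) L

_∈ₛ?_ : ∀ x L → Dec (x ∈ₛ L)
x ∈ₛ? L = Any.any? (λ y → Null? (x ∸ y)) L

-- The differences ψ (y + s) - ψ (y) of the map ψ below, for y even and for y odd.
twist′ : (x : Symbol) → (∃ λ u → proj₁ x ≡ u + u ⊎ proj₁ x ≡ u + u + 1ℤ) → Symbol × Symbol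
twist′ (i , e) (u , inj₁ _) = (i , e + u) , (i , e + u)
-- If y and the step are both odd, halving their sum produces a carry, hence the additional 1.
twist′ (i , e) (u , inj₂ _) = (i , e + u) , (i , e + u + 1ℤ)

twist : Symbol → Symbol × Symbol
twist x = twist′ x (parity (proj₁ x))

Twists : List Symbol → List Symbol → Set
Twists L L′ = All (λ x → proj₁ (twist x) ∈ₛ L′ × proj₂ (twist x) ∈ₛ L′) L

Twists? : ∀ L L′ → Dec (Twists L L′)
Twists? L L′ = All.all? (λ x → (proj₁ (twist x) ∈ₛ? L′) ×-dec (proj₂ (twist x) ∈ₛ? L′)) L

-- This separates `L` from all images under group automorphisms of a set containing both 1 and 2.
DoublingFree : ℕ → List Symbol → Set
DoublingFree B L = All (λ c → All (λ c′ → Small B (c ⊹ c ∸ c′) × ¬ Null (c ⊹ c ∸ c′)) L) L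

DoublingFree? : ∀ B L → Dec (DoublingFree B L)
DoublingFree? B L = All.all? (λ c → All.all? (λ c′ → Small? B (c ⊹ c ∸ c′) ×-dec ¬? (Null? (c ⊹ c ∸ c′))) L) L

-- In every transitive triangle the first two steps agree.
Isosceles : ℕ → List Symbol → Set
Isosceles B L = All (λ s → All (λ c → All (λ c′ →
  Small B (c ⊹ c′ ∸ s) × (Null (c ⊹ c′ ∸ s) → Null (c ∸ c′))) L) L) L

Isosceles? : ∀ B L → Dec (Isosceles B L)
Isosceles? B L = All.all? (λ s → All.all? (λ c → All.all? (λ c′ →
  Small? B (c ⊹ c′ ∸ s) ×-dec (Null? (c ⊹ c′ ∸ s) →-dec Null? (c ∸ c′))) L) L) L

ZeroFree : ℕ → List Symbol → Set
ZeroFree B L = All (λ x → Small B x × ¬ Null x) L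

ZeroFree? : ∀ B L → Dec (ZeroFree B L)
ZeroFree? B L = All.all? (λ x → Small? B x ×-dec ¬? (Null? x)) L

-- The map ψ, the isomorphisms it induces, and normality from triangles.

module Twisted (m q B : ℕ) (n≡8q : + suc m ≡ + q * + 8) (B≤4q : B ℕ.≤ q ℕ.* 4) where

  open Residues m

  h : ℤ
  h = + q * + 4

  val : Symbol → ℤ
  val (i , e) = i + e * h

  opaque
    N≡h+h : N ≡ h + h
    N≡h+h = trans n≡8q (s (+ q))
      where
      s : ∀ q → q * + 8 ≡ q * + 4 + q * + 4
      s = solve-∀

    N∣h+h : ∀ x → N ∣ℤ x * (h + h)
    N∣h+h x = divides x (cong (x *_) (sym N≡h+h))

    ≅0-by : ∀ {z} x → z ≡ x * (h + h) → N ∣ℤ z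
    ≅0-by x e = ∣-resp e (N∣h+h x)

    val-⊹ : ∀ x y → val (x ⊹ y) ≡ val x + val y
    val-⊹ (i , e) (j , f) = s i e j f h
      where
      s : ∀ i e j f h → i + j + (e + f) * h ≡ i + e * h + (j + f * h)
      s = solve-∀

    val-∸ : ∀ x y → val (x ∸ y) ≡ val x - val y
    val-∸ (i , e) (j , f) = s i e j f h
      where
      s : ∀ i e j f h → i - j + (e - f) * h ≡ i + e * h - (j + f * h)
      s = solve-∀

    val-negate : ∀ x → val (negate x) ≡ - val x
    val-negate (i , e) = s i e h
      where
      s : ∀ i e h → - i + - e * h ≡ - (i + e * h)
      s = solve-∀

    Null⇒ : ∀ x → Null x → N ∣ℤ val x
    Null⇒ (.0ℤ , e) (refl , divides f e≡f2) = ≅0-by f (trans (cong (λ e → 0ℤ + e * h) e≡f2) (s f h))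
      where
      s : ∀ f h → 0ℤ + f * + 2 * h ≡ f * (h + h)
      s = solve-∀

    Null-∸⇒ : ∀ x y → Null (x ∸ y) → val x ≅ val y [ N ]
    Null-∸⇒ x y null = ∣-resp (sym (val-∸ x y)) (Null⇒ (x ∸ y) null)

    -- Since h divides n, it divides `i`, and ∣ i ∣ < B ≤ h gives i ≡ 0. What remains is e h ≡ 0
    -- modulo 2 h, so `e` is even.
    Null⇐ : ∀ x → Small B x → N ∣ℤ val x → Null x
    Null⇐ (i , e) small d = i≡0 , even d
      where
      h≡ : h ≡ + (q ℕ.* 4)
      h≡ = sym (ℤₚ.pos-* q 4)
      h∣i : + (q ℕ.* 4) ∣ℤ i
      h∣i = subst (_∣ℤ i) h≡ (∣-resp (s i e h) (∣-trans (∣-resp (trans N≡h+h (s₂ h)) (+ 2 *∣ ∣-refl)) d ∣+ (- e) *∣ ∣-refl))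
        where
        s : ∀ i e h → i ≡ i + e * h + - e * h
        s = solve-∀
        s₂ : ∀ h → h + h ≡ + 2 * h
        s₂ = solve-∀
      i≡0 : i ≡ 0ℤ
      i≡0 = ∣∧<⇒≡0 h∣i (ℕₚ.<-≤-trans small B≤4q)
      h≢0 : ℤ.NonZero h
      h≢0 = ℤ.≢-nonZero λ h≡0 → ℕₚ.n≮0 (subst (∣ i ∣ ℕ.<_) (ℤₚ.+-injective (trans (sym h≡) h≡0)) (ℕₚ.<-≤-trans small B≤4q))
      even : N ∣ℤ i + e * h → + 2 ∣ℤ e
      even (divides c eq) = divides c (ℤₚ.*-cancelʳ-≡ e (c * + 2) h {{h≢0}}
        (trans (s e h) (trans (cong (_+ e * h) (sym i≡0)) (trans eq (trans (cong (c *_) N≡h+h) (s₂ c h))))))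
        where
        s : ∀ e h → e * h ≡ 0ℤ + e * h
        s = solve-∀
        s₂ : ∀ c h → c * (h + h) ≡ c * + 2 * h
        s₂ = solve-∀

  set : List Symbol → Subset (suc m)
  set []      = ∅
  set (x ∷ L) = ⁅ [ val x ] ⁆ ∪ set L

  opaque
    ∈-set⁻ : ∀ L i → [ i ] ∈ set L → ∃ λ x → x ∈ₗ L × i ≅ val x [ N ]
    ∈-set⁻ []      i i∈ = contradiction i∈ ∉⊥
    ∈-set⁻ (x ∷ L) i i∈ with x∈p∪q⁻ ⁅ [ val x ] ⁆ (set L) i∈
    ... | inj₁ i∈x = x , here refl , []-injective (x∈⁅y⁆⇒x≡y [ val x ] i∈x)
    ... | inj₂ i∈L with ∈-set⁻ L i i∈L
    ...   | y , y∈L , d = y , there y∈L , d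

    ∈-set⁺ : ∀ L i → Any (λ x → i ≅ val x [ N ]) L → [ i ] ∈ set L
    ∈-set⁺ (x ∷ L) i (here d)  = x∈p∪q⁺ (inj₁ (subst (_∈ ⁅ [ val x ] ⁆) ([]-cong {val x} {i} (≅-sym i (val x) d)) (x∈⁅x⁆ [ val x ])))
    ∈-set⁺ (x ∷ L) i (there d) = x∈p∪q⁺ {p = ⁅ [ val x ] ⁆} (inj₂ (∈-set⁺ L i d))

    ∈ₛ⇒∈ : ∀ L x i → i ≅ val x [ N ] → x ∈ₛ L → [ i ] ∈ set L
    ∈ₛ⇒∈ L x i d x∈L = ∈-set⁺ L i (Any.map (λ {y} null → ≅-trans i (val x) (val y) d (Null-∸⇒ x y null)) x∈L)

    ∈ₗ⇒∈ : ∀ L x → x ∈ₗ L → [ val x ] ∈ set L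
    ∈ₗ⇒∈ L x x∈L = ∈-set⁺ L (val x) (Any.map (λ { refl → ≅-refl (val x) }) x∈L)

  half : ℤ → ℤ
  half i = proj₁ (parity i)

  ψ : Fin (suc m) → Fin (suc m)
  ψ x = [ ⟨ x ⟩ + half ⟨ x ⟩ * h ]

  opaque
    h-even : h ≡ + q * + 2 + + q * + 2
    h-even = s (+ q)
      where
      s : ∀ q → q * + 4 ≡ q * + 2 + q * + 2
      s = solve-∀

    -- Divisibility of n by 8 makes h / 2 = 2 q even, so (h / 2) h is a multiple of n = 2 h.
    N∣h*h/2 : ∀ x → N ∣ℤ x * (+ q * + 2 * h)
    N∣h*h/2 x = ≅0-by (x * + q) (s x (+ q))
      where
      s : ∀ x q → x * (q * + 2 * (q * + 4)) ≡ x * q * (q * + 4 + q * + 4)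
      s = solve-∀

    -- This makes ψ independent of the representative: changing it by c n changes its half by c h,
    -- and both c n and c h h vanish modulo n.
    same-parity : ∀ p j k → k + k + p ≅ j + j + p [ N ] → j + j + p + j * h ≅ k + k + p + k * h [ N ]
    same-parity p j k (divides c eq) = ∣-resp (trans (cong (λ k → j + j + p + j * h - (k + k + p + k * h)) k≡) (s p j c h (+ q * + 2)
        h-even)) (N∣h+h (- c) ∣+ N∣h*h/2 (- c * + 2))
      where
      s₀ : ∀ p j k → (k - j) + (k - j) ≡ k + k + p - (j + j + p)
      s₀ = solve-∀
      s₁ : ∀ c h → c * (h + h) ≡ c * h + c * h
      s₁ = solve-∀
      s₂ : ∀ j k → k ≡ j + (k - j)
      s₂ = solve-∀
      k≡ : k ≡ j + c * h
      k≡ = trans (s₂ j k) (cong (_+_ j) (double-injective (trans (s₀ p j k) (trans eq (trans (cong (c *_) N≡h+h) (s₁ c h))))))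
      s′ : ∀ p j c h → j + j + p + j * h - (j + c * h + (j + c * h) + p + (j + c * h) * h) ≡
        - c * (h + h) + - c * (h * h)
      s′ = solve-∀
      s″ : ∀ c h g → - c * (h + h) + - c * ((g + g) * h) ≡ - c * (h + h) + - c * + 2 * (g * h)
      s″ = solve-∀
      s : ∀ p j c h g → h ≡ g + g → j + j + p + j * h - (j + c * h + (j + c * h) + p + (j + c * h) * h) ≡
        - c * (h + h) + - c * + 2 * (g * h)
      s p j c h g e = trans (s′ p j c h) (trans (cong (λ x → - c * (h + h) + - c * (x * h)) e) (s″ c h g))

    opposite-parity : ∀ j k → ¬ (k + k ≅ j + j + 1ℤ [ N ])
    opposite-parity j k (divides c eq) = from-no (+ 2 ∣? 1ℤ) (divides (k - j - c * h) (trans (s j k) (trans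
      (cong (λ z → k + k - (j + j) - z) (trans eq (cong (c *_) N≡h+h))) (s₂ j k c h))))
      where
      s : ∀ j k → 1ℤ ≡ k + k - (j + j) - (k + k - (j + j + 1ℤ))
      s = solve-∀
      s₂ : ∀ j k c h → k + k - (j + j) - c * (h + h) ≡ (k - j - c * h) * + 2
      s₂ = solve-∀

    x≡x+0 : ∀ x → x ≡ x + 0ℤ
    x≡x+0 x = sym (ℤₚ.+-identityʳ x)

    ψ-even : ∀ k → ψ [ k + k ] ≡ [ k + k + k * h ]
    ψ-even k = go (parity x) (⟨[]⟩ (k + k))
      where
      x : ℤ
      x = ⟨ [ k + k ] ⟩
      go : (p : ∃ λ j → x ≡ j + j ⊎ x ≡ j + j + 1ℤ) → k + k ≅ x [ N ] → [ x + proj₁ p * h ] ≡ [ k + k + k * h ]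
      go (j , inj₁ x≡) d = []-cong {x + j * h} {k + k + k * h}
        (subst (λ z → z + j * h ≅ k + k + k * h [ N ]) (sym x≡) (subst₂ (λ y z → y + j * h ≅ z + k * h [ N ]) (ℤₚ.+-identityʳ (j + j)) (ℤₚ.+-identityʳ (k + k))
          (same-parity 0ℤ j k (subst₂ (λ y z → y ≅ z [ N ]) (x≡x+0 (k + k)) (trans x≡ (x≡x+0 (j + j))) d))))
      go (j , inj₂ x≡) d = contradiction (subst (λ z → k + k ≅ z [ N ]) x≡ d) (opposite-parity j k)

    ψ-odd : ∀ k → ψ [ k + k + 1ℤ ] ≡ [ k + k + 1ℤ + k * h ]
    ψ-odd k = go (parity x) (⟨[]⟩ (k + k + 1ℤ))
      where
      x : ℤ
      x = ⟨ [ k + k + 1ℤ ] ⟩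
      go : (p : ∃ λ j → x ≡ j + j ⊎ x ≡ j + j + 1ℤ) → k + k + 1ℤ ≅ x [ N ] → [ x + proj₁ p * h ] ≡ [ k + k + 1ℤ + k * h ]
      go (j , inj₁ x≡) d = contradiction (≅-sym (k + k + 1ℤ) (j + j) (subst (λ z → k + k + 1ℤ ≅ z [ N ]) x≡ d)) (opposite-parity k j)
      go (j , inj₂ x≡) d = []-cong {x + j * h} {k + k + 1ℤ + k * h}
        (subst (λ z → z + j * h ≅ k + k + 1ℤ + k * h [ N ]) (sym x≡)
          (same-parity 1ℤ j k (subst (λ z → k + k + 1ℤ ≅ z [ N ]) x≡ d)))

    ψ-even′ : ∀ i k → i ≡ k + k → ψ [ i ] ≡ [ i + k * h ]
    ψ-even′ i k refl = ψ-even k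

    ψ-odd′ : ∀ i k → i ≡ k + k + 1ℤ → ψ [ i ] ≡ [ i + k * h ]
    ψ-odd′ i k refl = ψ-odd k

    -- The first application adds k h, which is even, so the half becomes k + k (h / 2). In total 2
    -- k h + k (h / 2) h is added, a multiple of n.
    ψ-involutive : ∀ x → ψ (ψ x) ≡ x
    ψ-involutive x = go (lift x)
      where
      g : ℤ
      g = + q * + 2
      s₀ : ∀ k g → k + k + k * (g + g) ≡ (k + k * g) + (k + k * g)
      s₀ = solve-∀
      s₁ : ∀ k g → k + k + 1ℤ + k * (g + g) ≡ (k + k * g) + (k + k * g) + 1ℤ
      s₁ = solve-∀
      s₂ : ∀ i k g h → i + k * h + (k + k * g) * h - i ≡ k * (h + h) + k * (g * h)
      s₂ = solve-∀
      cancel : ∀ i k → [ i + k * h + (k + k * g) * h ] ≡ [ i ]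
      cancel i k = []-cong {i + k * h + (k + k * g) * h} {i} (∣-resp (s₂ i k g h) (N∣h+h k ∣+ N∣h*h/2 k))
      go′ : ∀ i → (∃ λ k → i ≡ k + k ⊎ i ≡ k + k + 1ℤ) → ψ (ψ [ i ]) ≡ [ i ]
      go′ i (k , inj₁ e) = trans (cong ψ (ψ-even′ i k e)) (trans
        (ψ-even′ (i + k * h) (k + k * g) (trans (cong₂ (λ i h → i + k * h) e h-even) (s₀ k g))) (cancel i k))
      go′ i (k , inj₂ e) = trans (cong ψ (ψ-odd′ i k e)) (trans
        (ψ-odd′ (i + k * h) (k + k * g) (trans (cong₂ (λ i h → i + k * h) e h-even) (s₁ k g))) (cancel i k))
      go : (∃ λ i → [ i ] ≡ x) → ψ (ψ x) ≡ x
      go (i , refl) = go′ i (parity i)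

  ψₚ : Permutation′ (suc m)
  ψₚ = permutation ψ ψ ψ-involutive ψ-involutive

  opaque
    ZeroFree⇒ : ∀ L → ZeroFree B L → Fin.zero ∉ set L
    ZeroFree⇒ L free 0∈L = go (∈-set⁻ L 0ℤ (subst (_∈ set L) zero≡[0] 0∈L))
      where
      s : ∀ x → x ≡ - 1ℤ * (0ℤ - x)
      s = solve-∀
      go : (∃ λ x → x ∈ₗ L × 0ℤ ≅ val x [ N ]) → ⊥
      go (x , x∈L , d) = proj₂ (All.lookup free x∈L) (Null⇐ x (proj₁ (All.lookup free x∈L)) (∣-resp (s (val x)) (- 1ℤ *∣ d)))

    negation-closed⇒Symmetric : ∀ L → All (λ x → negate x ∈ₛ L) L → Symmetric m (set L)
    negation-closed⇒Symmetric L neg x y = go (lift x) (lift y)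
      where
      s : ∀ i j v → j - - v ≡ (j + i - 0ℤ) + - 1ℤ * (i - v)
      s = solve-∀
      go : (∃ λ i → [ i ] ≡ x) → (∃ λ j → [ j ] ≡ y) → y ⊞ x ≡ Fin.zero → x ∈ set L → y ∈ set L
      go (i , refl) (j , refl) eq x∈L = go′ (∈-set⁻ L i x∈L)
        where
        j+i≅0 : j + i ≅ 0ℤ [ N ]
        j+i≅0 = []-injective {j + i} (trans (sym ([]-⊞ j i)) (trans eq zero≡[0]))
        go′ : (∃ λ v → v ∈ₗ L × i ≅ val v [ N ]) → [ j ] ∈ set L
        go′ (v , v∈L , d) = ∈ₛ⇒∈ L (negate v) j (subst (λ z → j ≅ z [ N ]) (sym (val-negate v))
          (∣-resp (s i j (val v)) (j+i≅0 ∣+ - 1ℤ *∣ d))) (All.lookup neg v∈L)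

    -- The part e h of the step raises the half by e (h / 2), which contributes nothing modulo n.
    -- Only the half of the first component and a possible carry remain. The parities are arguments
    -- so that matching on them makes `twist′` compute.
    ψ-+-twist : ∀ x i (px : ∃ λ u → proj₁ x ≡ u + u ⊎ proj₁ x ≡ u + u + 1ℤ) →
      (∃ λ k → i ≡ k + k ⊎ i ≡ k + k + 1ℤ) →
      ∃ λ w → ψ [ i ] ≡ [ w ] × (ψ [ i + val x ] ≡ [ w + val (proj₁ (twist′ x px)) ] ⊎ ψ [ i + val x ] ≡ [ w + val (proj₂ (twist′ x px)) ])
    ψ-+-twist (a , e) i px pi = go px pi
      where
      g : ℤ
      g = + q * + 2
      s₀₀ : ∀ k u e g → k + k + (u + u + e * (g + g)) ≡ (k + u + e * g) + (k + u + e * g)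
      s₀₀ = solve-∀
      s₀₁ : ∀ k u e g → k + k + (u + u + 1ℤ + e * (g + g)) ≡ (k + u + e * g) + (k + u + e * g) + 1ℤ
      s₀₁ = solve-∀
      s₁₀ : ∀ k u e g → k + k + 1ℤ + (u + u + e * (g + g)) ≡ (k + u + e * g) + (k + u + e * g) + 1ℤ
      s₁₀ = solve-∀
      s₁₁ : ∀ k u e g → k + k + 1ℤ + (u + u + 1ℤ + e * (g + g)) ≡ (k + u + 1ℤ + e * g) + (k + u + 1ℤ + e * g)
      s₁₁ = solve-∀
      t₀ : ∀ i a k u e g h → i + (a + e * h) + (k + u + e * g) * h - (i + k * h + (a + (e + u) * h)) ≡ e * (g * h)
      t₀ = solve-∀
      t₁ : ∀ i a k u e g h → i + (a + e * h) + (k + u + 1ℤ + e * g) * h - (i + k * h + (a + (e + u + 1ℤ) * h)) ≡ e * (g * h)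
      t₁ = solve-∀
      same : ∀ k u → [ i + (a + e * h) + (k + u + e * g) * h ] ≡ [ i + k * h + (a + (e + u) * h) ]
      same k u = []-cong {i + (a + e * h) + (k + u + e * g) * h} (∣-resp (t₀ i a k u e g h) (N∣h*h/2 e))
      carry : ∀ k u → [ i + (a + e * h) + (k + u + 1ℤ + e * g) * h ] ≡ [ i + k * h + (a + (e + u + 1ℤ) * h) ]
      carry k u = []-cong {i + (a + e * h) + (k + u + 1ℤ + e * g) * h} (∣-resp (t₁ i a k u e g h) (N∣h*h/2 e))
      expand : ∀ {i′ a′} → i ≡ i′ → a ≡ a′ → i + (a + e * h) ≡ i′ + (a′ + e * (g + g))
      expand i≡ a≡ = cong₂ (λ i z → i + z) i≡ (cong₂ (λ a h → a + e * h) a≡ h-even)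
      go : (px : ∃ λ u → a ≡ u + u ⊎ a ≡ u + u + 1ℤ) → (∃ λ k → i ≡ k + k ⊎ i ≡ k + k + 1ℤ) →
        ∃ λ w → ψ [ i ] ≡ [ w ] × (ψ [ i + (a + e * h) ] ≡ [ w + val (proj₁ (twist′ (a , e) px)) ] ⊎ ψ [ i + (a + e * h) ] ≡ [ w + val (proj₂ (twist′ (a , e) px)) ])
      go (u , inj₁ a≡) (k , inj₁ i≡) = i + k * h , ψ-even′ i k i≡ , inj₁
        (trans (ψ-even′ (i + (a + e * h)) (k + u + e * g) (trans (expand i≡ a≡) (s₀₀ k u e g))) (same k u))
      go (u , inj₂ a≡) (k , inj₁ i≡) = i + k * h , ψ-even′ i k i≡ , inj₁
        (trans (ψ-odd′ (i + (a + e * h)) (k + u + e * g) (trans (expand i≡ a≡) (s₀₁ k u e g))) (same k u))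
      go (u , inj₁ a≡) (k , inj₂ i≡) = i + k * h , ψ-odd′ i k i≡ , inj₂
        (trans (ψ-odd′ (i + (a + e * h)) (k + u + e * g) (trans (expand i≡ a≡) (s₁₀ k u e g))) (same k u))
      go (u , inj₂ a≡) (k , inj₂ i≡) = i + k * h , ψ-odd′ i k i≡ , inj₂
        (trans (ψ-even′ (i + (a + e * h)) (k + u + 1ℤ + e * g) (trans (expand i≡ a≡) (s₁₁ k u e g))) (carry k u))

    ψ-arc : ∀ L L′ → Twists L L′ → ∀ x y → Arc m (set L) x y → Arc m (set L′) (ψ x) (ψ y)
    ψ-arc L L′ tw x y = go (lift x) (lift y)
      where
      s : ∀ w t → t ≡ w + t - w
      s = solve-∀
      s₂ : ∀ i j v → j - (i + v) ≡ j - i - v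
      s₂ = solve-∀
      target : ∀ w t → t ∈ₛ L′ → Arc m (set L′) [ w ] [ w + val t ]
      target w t t∈L′ = arc⁺ w (w + val t) (∈ₛ⇒∈ L′ t (w + val t - w) (≅-reflexive {i = w + val t - w} (sym (s w (val t)))) t∈L′)
      go : (∃ λ i → [ i ] ≡ x) → (∃ λ j → [ j ] ≡ y) → Arc m (set L) x y → Arc m (set L′) (ψ x) (ψ y)
      go (i , refl) (j , refl) a = go′ (∈-set⁻ L (j - i) (arc⁻ i j a))
        where
        go′ : (∃ λ v → v ∈ₗ L × j - i ≅ val v [ N ]) → Arc m (set L′) (ψ [ i ]) (ψ [ j ])
        go′ (v , v∈L , d) = go″ (ψ-+-twist v i (parity (proj₁ v)) (parity i))
          where
          j≡ : [ j ] ≡ [ i + val v ]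
          j≡ = []-cong {j} {i + val v} (∣-resp (s₂ i j (val v)) d)
          go″ : (∃ λ w → ψ [ i ] ≡ [ w ] × (ψ [ i + val v ] ≡ [ w + val (proj₁ (twist v)) ] ⊎ ψ [ i + val v ] ≡ [ w + val (proj₂ (twist v)) ])) →
            Arc m (set L′) (ψ [ i ]) (ψ [ j ])
          go″ (w , ψi , inj₁ ψj) = subst₂ (Arc m (set L′)) (sym ψi) (trans (sym ψj) (cong ψ (sym j≡))) (target w (proj₁ (twist v)) (proj₁ (All.lookup tw v∈L)))
          go″ (w , ψi , inj₂ ψj) = subst₂ (Arc m (set L′)) (sym ψi) (trans (sym ψj) (cong ψ (sym j≡))) (target w (proj₂ (twist v)) (proj₂ (All.lookup tw v∈L)))

    twists⇒isomorphic : ∀ L L′ → Twists L L′ → Twists L′ L → Isomorphic m (set L) (set L′)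
    twists⇒isomorphic L L′ tw tw′ = ψₚ , λ x y → mk⇔ (ψ-arc L L′ tw x y)
      (λ a → subst₂ (Arc m (set L)) (ψ-involutive x) (ψ-involutive y) (ψ-arc L′ L tw′ (ψ x) (ψ y) a))

    -- A group automorphism from Cay L to Cay L′ would send 1 to some c in L′ with 2 c in L′.
    doubling-free⇒¬CI : ∀ L L′ → Twists L L′ → Twists L′ L → (1ℤ , 0ℤ) ∈ₗ L → (+ 2 , 0ℤ) ∈ₗ L → DoublingFree B L′ → ¬ IsCI m (set L)
    doubling-free⇒¬CI L L′ tw tw′ 1∈L 2∈L free CI = go (CI (set L′) (twists⇒isomorphic L L′ tw tw′))
      where
      one two : ℤ
      one = val (1ℤ , 0ℤ)
      two = val (+ 2 , 0ℤ)
      s : ∀ u x y → x + x - y ≡ (u + u - y) + - + 2 * (u - x)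
      s = solve-∀
      impossible : ∀ u → [ u ] ∈ set L′ → [ u + u ] ∈ set L′ → ⊥
      impossible u u∈ 2u∈ = go (∈-set⁻ L′ u u∈) (∈-set⁻ L′ (u + u) 2u∈)
        where
        go : (∃ λ x → x ∈ₗ L′ × u ≅ val x [ N ]) → (∃ λ y → y ∈ₗ L′ × u + u ≅ val y [ N ]) → ⊥
        go (x , x∈ , d) (y , y∈ , d′) = proj₂ chk (Null⇐ (x ⊹ x ∸ y) (proj₁ chk) (∣-resp
          (trans (val-∸ (x ⊹ x) y) (trans (cong (_- val y) (val-⊹ x x)) (s u (val x) (val y)))) (d′ ∣+ (- + 2) *∣ d)))
          where
          chk : Small B (x ⊹ x ∸ y) × ¬ Null (x ⊹ x ∸ y)
          chk = All.lookup (All.lookup free x∈) y∈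
      go : (∃ λ σ → IsGroupAut m σ × _≡Image_under_ m (set L′) (set L) σ) → ⊥
      go (σ , additive , image) = go′ (lift (σ ⟨$⟩ʳ [ one ]))
        where
        image∈ : ∀ x → x ∈ₗ L → σ ⟨$⟩ʳ [ val x ] ∈ set L′
        image∈ x x∈L = from (image (σ ⟨$⟩ʳ [ val x ])) ([ val x ] , ∈ₗ⇒∈ L x x∈L , refl)
        go′ : (∃ λ u → [ u ] ≡ σ ⟨$⟩ʳ [ one ]) → ⊥
        go′ (u , [u]≡) = impossible u (subst (_∈ set L′) (sym [u]≡) (image∈ (1ℤ , 0ℤ) 1∈L))
          (subst (_∈ set L′) 2u≡ (image∈ (+ 2 , 0ℤ) 2∈L))
          where
          2u≡ : σ ⟨$⟩ʳ [ two ] ≡ [ u + u ]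
          2u≡ = trans (cong (σ ⟨$⟩ʳ_) (trans (cong [_] (val-⊹ (1ℤ , 0ℤ) (1ℤ , 0ℤ))) (sym ([]-⊞ one one))))
            (trans (additive [ one ] [ one ]) (trans (cong₂ _⊞_ (sym [u]≡) (sym [u]≡)) ([]-⊞ u u)))

  module _ (σ : Permutation′ (suc m)) where

    F : ℤ → ℤ
    F i = ⟨ σ ⟨$⟩ʳ [ i ] ⟩

    opaque
      [F] : ∀ i → [ F i ] ≡ σ ⟨$⟩ʳ [ i ]
      [F] i = [⟨⟩] (σ ⟨$⟩ʳ [ i ])

      -- Vanishing second differences make all increments equal to F 1 - F 0.
      balanced⇒affine : (∀ i → F (1ℤ + (1ℤ + i)) - F (1ℤ + i) ≅ F (1ℤ + i) - F i [ N ]) →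
        ∃₂ λ a b → ∀ i → σ ⟨$⟩ʳ [ i ] ≡ [ b + a * i ]
      balanced⇒affine balanced = a , F 0ℤ , affine-from-step (σ ⟨$⟩ʳ_) a (F 0ℤ) (sym ([F] 0ℤ)) step
        where
        a : ℤ
        a = F 1ℤ - F 0ℤ
        constant : ∀ k → F (1ℤ + + k) - F (+ k) ≅ a [ N ]
        constant zero    = ≅-refl a
        constant (suc k) = ≅-trans (F (1ℤ + (1ℤ + + k)) - F (1ℤ + + k)) (F (1ℤ + + k) - F (+ k)) a (balanced (+ k)) (constant k)
        s : ∀ x y a → x - (y + a) ≡ x - y - a
        s = solve-∀
        s₁ : ∀ i k → 1ℤ + i - (1ℤ + k) ≡ i - k
        s₁ = solve-∀
        step : ∀ i → σ ⟨$⟩ʳ [ 1ℤ + i ] ≡ (σ ⟨$⟩ʳ [ i ]) ⊞ [ a ]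
        step i = trans (cong (σ ⟨$⟩ʳ_) ([]-cong {1ℤ + i} {1ℤ + k} (∣-resp (s₁ i k) (residue (suc m) i))))
          (trans (sym ([F] (1ℤ + k))) (trans ([]-cong {F (1ℤ + k)} {F k + a} (∣-resp (s (F (1ℤ + k)) (F k) a) (constant (i %ℕ suc m))))
          (trans (sym ([]-⊞ (F k) a)) (cong (_⊞ [ a ]) (trans ([F] k) (cong (σ ⟨$⟩ʳ_) (natural-lift i)))))))
          where
          k : ℤ
          k = + (i %ℕ suc m)

      aut-difference : ∀ {S} → IsDigraphAut m S σ → ∀ i j → [ j - i ] ∈ S → [ F j - F i ] ∈ S
      aut-difference {S} aut i j d = arc⁻ (F i) (F j) (subst₂ (Arc m S) (sym ([F] i)) (sym ([F] j)) (to (aut [ i ] [ j ]) (arc⁺ i j d)))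

  opaque
    val-integer : ∀ i → i ≡ val (i , 0ℤ)
    val-integer i = s i h
      where
      s : ∀ x h → x ≡ x + 0ℤ * h
      s = solve-∀

    [integer]∈ : ∀ L {i} → (i , 0ℤ) ∈ₗ L → [ i ] ∈ set L
    [integer]∈ L {i} i∈ = subst (_∈ set L) (cong [_] (sym (val-integer i))) (∈ₗ⇒∈ L (i , 0ℤ) i∈)

    N∣⊹∸ : ∀ i j x y z → i ≅ val x [ N ] → j ≅ val y [ N ] → i + j ≅ val z [ N ] → N ∣ℤ val (x ⊹ y ∸ z)
    N∣⊹∸ i j x y z dx dy dz =
      ∣-resp (trans (val-∸ (x ⊹ y) z) (trans (cong (_- val z) (val-⊹ x y)) (s i j (val x) (val y) (val z))))
        (dz ∣+ - 1ℤ *∣ dx ∣+ - 1ℤ *∣ dy)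
      where
      s : ∀ i j x y z → x + y - z ≡ (i + j - z) + (- 1ℤ * (i - x) + - 1ℤ * (j - y))
      s = solve-∀

    isosceles-triangle : ∀ L → Isosceles B L → ∀ i j → [ i ] ∈ set L → [ j ] ∈ set L → [ i + j ] ∈ set L → i ≅ j [ N ]
    isosceles-triangle L iso i j i∈ j∈ k∈ = go (∈-set⁻ L i i∈) (∈-set⁻ L j j∈) (∈-set⁻ L (i + j) k∈)
      where
      go : (∃ λ x → x ∈ₗ L × i ≅ val x [ N ]) → (∃ λ y → y ∈ₗ L × j ≅ val y [ N ]) → (∃ λ z → z ∈ₗ L × i + j ≅ val z [ N ]) → i ≅ j [ N ]
      go (x , x∈ , dx) (y , y∈ , dy) (z , z∈ , dz) =
        ≅-trans i (val x) j dx (≅-trans (val x) (val y) j (Null-∸⇒ x y (proj₂ chk (Null⇐ (x ⊹ y ∸ z) (proj₁ chk) (N∣⊹∸ i j x y z dx dy dz)))) (≅-sym j (val y) dy))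
        where
        chk : Small B (x ⊹ y ∸ z) × (Null (x ⊹ y ∸ z) → Null (x ∸ y))
        chk = All.lookup (All.lookup (All.lookup iso z∈) x∈) y∈

    -- The vertices i, i + 1, i + 2 form a transitive triangle, and the short sides of its image
    -- must agree; hence σ has constant increments.
    isosceles⇒normal : ∀ L → Isosceles B L → (1ℤ , 0ℤ) ∈ₗ L → (+ 2 , 0ℤ) ∈ₗ L → IsNormal m (set L)
    isosceles⇒normal L iso 1∈L 2∈L = affine⇒normal λ σ aut → balanced⇒affine σ λ i →
      isosceles-triangle L iso (F σ (1ℤ + (1ℤ + i)) - F σ (1ℤ + i)) (F σ (1ℤ + i) - F σ i)
        (aut-difference σ aut (1ℤ + i) (1ℤ + (1ℤ + i)) (subst (_∈ set L) (cong [_] (s₁ (1ℤ + i))) ([integer]∈ L 1∈L)))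
        (aut-difference σ aut i (1ℤ + i) (subst (_∈ set L) (cong [_] (s₁ i)) ([integer]∈ L 1∈L)))
        (subst (_∈ set L) (cong [_] (s (F σ i) (F σ (1ℤ + i)) (F σ (1ℤ + (1ℤ + i)))))
          (aut-difference σ aut i (1ℤ + (1ℤ + i)) (subst (_∈ set L) (cong [_] (s₂ i)) ([integer]∈ L 2∈L))))
      where
      s : ∀ x y z → z - x ≡ z - y + (y - x)
      s = solve-∀
      s₁ : ∀ i → 1ℤ ≡ 1ℤ + i - i
      s₁ = solve-∀
      s₂ : ∀ i → + 2 ≡ 1ℤ + (1ℤ + i) - i
      s₂ = solve-∀

-- The normal digraph without the CI property.

D D′ : List Symbol
D  = (1ℤ , 0ℤ) ∷ (1ℤ , 1ℤ) ∷ (+ 2 , 0ℤ) ∷ []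
D′ = (1ℤ , 0ℤ) ∷ (1ℤ , 1ℤ) ∷ (+ 2 , 1ℤ) ∷ []

opaque
  8∣n⇒¬NDCI : ∀ m → 8 ∣ suc m → ¬ NDCI m
  8∣n⇒¬NDCI m (ℕ∣.divides zero ())
  8∣n⇒¬NDCI m (ℕ∣.divides (suc q) n≡) ndci =
    doubling-free⇒¬CI D D′ (from-yes (Twists? D D′)) (from-yes (Twists? D′ D)) (here refl) (there (there (here refl)))
      (from-yes (DoublingFree? 4 D′))
      (ndci (set D) (ZeroFree⇒ D (from-yes (ZeroFree? 4 D)))
        (isosceles⇒normal D (from-yes (Isosceles? 4 D)) (here refl) (there (there (here refl)))))
    where
    n≡′ : + suc m ≡ + suc q * + 8
    n≡′ = trans (cong +_ n≡) (ℤₚ.pos-* (suc q) 8)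
    -- The bound 4 is the value of h for n = 8; the first components tested by the checks on `D` and
    -- `D′` stay below it.
    open Twisted m (suc q) 4 n≡′ (ℕₚ.m≤m+n 4 (q ℕ.* 4))

-- The undirected case: recognising edges by their common neighbours.

Apart : ℕ → Symbol → Symbol → Set
Apart B x y = Small B (x ∸ y) × ¬ Null (x ∸ y)

Apart? : ∀ B x y → Dec (Apart B x y)
Apart? B x y = Small? B (x ∸ y) ×-dec ¬? (Null? (x ∸ y))

-- The paths of length two from 0 to 2 run through 1 or 1 + h, and those from 0 to -2 have equal steps.
Apexes : ℕ → List Symbol → Set
Apexes B L = All (λ c → All (λ c′ →
  (Small B (c ⊹ c′ ∸ (+ 2 , 0ℤ)) × (Null (c ⊹ c′ ∸ (+ 2 , 0ℤ)) →
    Null (c ∸ c′) × (Null (c ∸ (1ℤ , 0ℤ)) ⊎ Null (c ∸ (1ℤ , 1ℤ))))) ×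
  (Small B (c ⊹ c′ ∸ (- + 2 , 0ℤ)) × (Null (c ⊹ c′ ∸ (- + 2 , 0ℤ)) → Null (c ∸ c′)))) L) L

Apexes? : ∀ B L → Dec (Apexes B L)
Apexes? B L = All.all? (λ c → All.all? (λ c′ →
  (Small? B (c ⊹ c′ ∸ (+ 2 , 0ℤ)) ×-dec (Null? (c ⊹ c′ ∸ (+ 2 , 0ℤ)) →-dec
    (Null? (c ∸ c′) ×-dec (Null? (c ∸ (1ℤ , 0ℤ)) ⊎-dec Null? (c ∸ (1ℤ , 1ℤ)))))) ×-dec
  (Small? B (c ⊹ c′ ∸ (- + 2 , 0ℤ)) ×-dec (Null? (c ⊹ c′ ∸ (- + 2 , 0ℤ)) →-dec Null? (c ∸ c′)))) L) L

ThreeApexes : ℕ → List Symbol → Symbol → Set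
ThreeApexes B L x = Any (λ e₁ → x ∸ e₁ ∈ₛ L × Any (λ e₂ → (x ∸ e₂ ∈ₛ L × Apart B e₁ e₂) ×
  Any (λ e₃ → x ∸ e₃ ∈ₛ L × Apart B e₁ e₃ × Apart B e₂ e₃) L) L) L

ThreeApexes? : ∀ B L x → Dec (ThreeApexes B L x)
ThreeApexes? B L x = Any.any? (λ e₁ → (x ∸ e₁ ∈ₛ? L) ×-dec Any.any? (λ e₂ → ((x ∸ e₂ ∈ₛ? L) ×-dec Apart? B e₁ e₂) ×-dec
  Any.any? (λ e₃ → (x ∸ e₃ ∈ₛ? L) ×-dec (Apart? B e₁ e₃ ×-dec Apart? B e₂ e₃)) L) L) L

-- The edges ± 2 have at most two common neighbours, every other edge has at least three.
Distinguished : ℕ → List Symbol → Set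
Distinguished B L = All (λ x → (Null (x ∸ (+ 2 , 0ℤ)) ⊎ Null (x ∸ (- + 2 , 0ℤ))) ⊎ ThreeApexes B L x) L

Distinguished? : ∀ B L → Dec (Distinguished B L)
Distinguished? B L = All.all? (λ x → (Null? (x ∸ (+ 2 , 0ℤ)) ⊎-dec Null? (x ∸ (- + 2 , 0ℤ))) ⊎-dec ThreeApexes? B L x) L

module TwistedGraph (m q B : ℕ) (n≡8q : + suc m ≡ + q * + 8) (B≤4q : B ℕ.≤ q ℕ.* 4)
  (L : List Symbol) (1∈L : (1ℤ , 0ℤ) ∈ₗ L) (2∈L : (+ 2 , 0ℤ) ∈ₗ L) (apexes : Apexes B L) (distinguished : Distinguished B L) where

  open Residues m
  open Twisted m q B n≡8q B≤4q

  opaque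
    -- Both signs have to be covered because an automorphism may reverse the direction of a step 2.
    equal-steps : ∀ i j → [ i ] ∈ set L → [ j ] ∈ set L →
      i + j ≅ val (+ 2 , 0ℤ) [ N ] ⊎ i + j ≅ val (- + 2 , 0ℤ) [ N ] → i ≅ j [ N ]
    equal-steps i j i∈ j∈ d = go (∈-set⁻ L i i∈) (∈-set⁻ L j j∈) d
      where
      go : (∃ λ x → x ∈ₗ L × i ≅ val x [ N ]) → (∃ λ y → y ∈ₗ L × j ≅ val y [ N ]) →
        i + j ≅ val (+ 2 , 0ℤ) [ N ] ⊎ i + j ≅ val (- + 2 , 0ℤ) [ N ] → i ≅ j [ N ]
      go (x , x∈ , dx) (y , y∈ , dy) d = ≅-trans i (val x) j dx (≅-trans (val x) (val y) j (Null-∸⇒ x y (null d)) (≅-sym j (val y) dy))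
        where
        null : i + j ≅ val (+ 2 , 0ℤ) [ N ] ⊎ i + j ≅ val (- + 2 , 0ℤ) [ N ] → Null (x ∸ y)
        null (inj₁ d) = proj₁ (proj₂ chk (Null⇐ (x ⊹ y ∸ (+ 2 , 0ℤ)) (proj₁ chk) (N∣⊹∸ i j x y (+ 2 , 0ℤ) dx dy d)))
          where
          chk : Small B (x ⊹ y ∸ (+ 2 , 0ℤ)) × (Null (x ⊹ y ∸ (+ 2 , 0ℤ)) → Null (x ∸ y) × (Null (x ∸ (1ℤ , 0ℤ)) ⊎ Null (x ∸ (1ℤ , 1ℤ))))
          chk = proj₁ (All.lookup (All.lookup apexes x∈) y∈)
        null (inj₂ d) = proj₂ chk (Null⇐ (x ⊹ y ∸ (- + 2 , 0ℤ)) (proj₁ chk) (N∣⊹∸ i j x y (- + 2 , 0ℤ) dx dy d))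
          where
          chk : Small B (x ⊹ y ∸ (- + 2 , 0ℤ)) × (Null (x ⊹ y ∸ (- + 2 , 0ℤ)) → Null (x ∸ y))
          chk = proj₂ (All.lookup (All.lookup apexes x∈) y∈)

    apex : ∀ t → [ t ] ∈ set L → [ + 2 - t ] ∈ set L → t ≅ val (1ℤ , 0ℤ) [ N ] ⊎ t ≅ val (1ℤ , 1ℤ) [ N ]
    apex t t∈ t′∈ = go (∈-set⁻ L t t∈) (∈-set⁻ L (+ 2 - t) t′∈)
      where
      s : ∀ t → t + (+ 2 - t) ≡ + 2
      s = solve-∀
      go : (∃ λ x → x ∈ₗ L × t ≅ val x [ N ]) → (∃ λ y → y ∈ₗ L × + 2 - t ≅ val y [ N ]) → t ≅ val (1ℤ , 0ℤ) [ N ] ⊎ t ≅ val (1ℤ , 1ℤ) [ N ]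
      go (x , x∈ , dx) (y , y∈ , dy) = finish (proj₂ (proj₂ chk (Null⇐ (x ⊹ y ∸ (+ 2 , 0ℤ)) (proj₁ chk)
          (N∣⊹∸ t (+ 2 - t) x y (+ 2 , 0ℤ) dx dy (≅-reflexive {i = t + (+ 2 - t)} (trans (s t) (val-integer (+ 2))))))))
        where
        chk : Small B (x ⊹ y ∸ (+ 2 , 0ℤ)) × (Null (x ⊹ y ∸ (+ 2 , 0ℤ)) → Null (x ∸ y) × (Null (x ∸ (1ℤ , 0ℤ)) ⊎ Null (x ∸ (1ℤ , 1ℤ))))
        chk = proj₁ (All.lookup (All.lookup apexes x∈) y∈)
        finish : Null (x ∸ (1ℤ , 0ℤ)) ⊎ Null (x ∸ (1ℤ , 1ℤ)) → t ≅ val (1ℤ , 0ℤ) [ N ] ⊎ t ≅ val (1ℤ , 1ℤ) [ N ]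
        finish (inj₁ null) = inj₁ (≅-trans t (val x) (val (1ℤ , 0ℤ)) dx (Null-∸⇒ x (1ℤ , 0ℤ) null))
        finish (inj₂ null) = inj₂ (≅-trans t (val x) (val (1ℤ , 1ℤ)) dx (Null-∸⇒ x (1ℤ , 1ℤ) null))

  module _ (σ : Permutation′ (suc m)) (aut : IsDigraphAut m (set L) σ) (i : ℤ) where

    i+2 : ℤ
    i+2 = 1ℤ + (1ℤ + i)

    -- A common neighbour of the images of i and i + 2 is pulled back to i + t. This is a common
    -- neighbour of i and i + 2, which leaves only two classes for `t`.
    Preimage : Symbol → ℤ → Set
    Preimage e t = σ ⟨$⟩ʳ [ i + t ] ≡ [ F σ i + val e ] × (t ≅ val (1ℤ , 0ℤ) [ N ] ⊎ t ≅ val (1ℤ , 1ℤ) [ N ])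

    opaque
      common-neighbour : ∀ x e → F σ i+2 - F σ i ≅ val x [ N ] → e ∈ₗ L → x ∸ e ∈ₛ L → ∃ (Preimage e)
      common-neighbour x e d e∈ x-e∈ = go (lift (σ ⟨$⟩ˡ [ F σ i + val e ]))
        where
        s₀ : ∀ i y → i + (y - i) ≡ y
        s₀ = solve-∀
        s₁ : ∀ w v → w + v - w ≡ v
        s₁ = solve-∀
        s₂ : ∀ i y → 1ℤ + (1ℤ + i) - y ≡ + 2 - (y - i)
        s₂ = solve-∀
        s₃ : ∀ z w v → z - (w + v) ≡ z - w - v
        s₃ = solve-∀
        s₄ : ∀ z w v x → z - w - v - (x - v) ≡ z - w - x
        s₄ = solve-∀
        go : (∃ λ y → [ y ] ≡ σ ⟨$⟩ˡ [ F σ i + val e ]) → ∃ (Preimage e)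
        go (y , [y]≡) = y - i , trans (cong (λ z → σ ⟨$⟩ʳ [ z ]) (s₀ i y)) σy ,
          apex (y - i) (arc⁻ i y (from (aut [ i ] [ y ]) arc₁))
            (subst (_∈ set L) (cong [_] (s₂ i y)) (arc⁻ y i+2 (from (aut [ y ] [ i+2 ]) arc₂)))
          where
          σy : σ ⟨$⟩ʳ [ y ] ≡ [ F σ i + val e ]
          σy = trans (cong (σ ⟨$⟩ʳ_) [y]≡) (inverseʳ σ)
          arc₁ : Arc m (set L) (σ ⟨$⟩ʳ [ i ]) (σ ⟨$⟩ʳ [ y ])
          arc₁ = subst₂ (Arc m (set L)) ([F] σ i) (sym σy)
            (arc⁺ (F σ i) (F σ i + val e) (subst (_∈ set L) (cong [_] (sym (s₁ (F σ i) (val e)))) (∈ₗ⇒∈ L e e∈)))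
          arc₂ : Arc m (set L) (σ ⟨$⟩ʳ [ y ]) (σ ⟨$⟩ʳ [ i+2 ])
          arc₂ = subst₂ (Arc m (set L)) (sym σy) ([F] σ i+2)
            (arc⁺ (F σ i + val e) (F σ i+2) (∈ₛ⇒∈ L (x ∸ e) (F σ i+2 - (F σ i + val e))
              (∣-resp (trans (cong₂ _-_ (s₃ (F σ i+2) (F σ i) (val e)) (val-∸ x e)) (s₄ (F σ i+2) (F σ i) (val e) (val x))) d) x-e∈))

      preimages-apart : ∀ e e′ {t t′ v} → Apart B e e′ → Preimage e t → Preimage e′ t′ → t ≅ v [ N ] → ¬ t′ ≅ v [ N ]
      preimages-apart e e′ {t} {t′} {v} (small , ¬null) (σt , _) (σt′ , _) d d′ = ¬null (Null⇐ (e ∸ e′) small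
        (∣-resp (trans (val-∸ e e′) (s (F σ i) (val e) (val e′))) ([]-injective {F σ i + val e} (trans (sym σt) (trans (cong (σ ⟨$⟩ʳ_) i+t≡) σt′)))))
        where
        s : ∀ w x y → x - y ≡ w + x - (w + y)
        s = solve-∀
        s₁ : ∀ i x y → i + x - (i + y) ≡ x - y
        s₁ = solve-∀
        i+t≡ : [ i + t ] ≡ [ i + t′ ]
        i+t≡ = []-cong {i + t} {i + t′} (∣-resp (s₁ i t t′) (≅-trans t v t′ d (≅-sym t′ v d′)))

      pigeonhole : ∀ e₁ e₂ e₃ → Apart B e₁ e₂ → Apart B e₁ e₃ → Apart B e₂ e₃ →
        ∃ (Preimage e₁) → ∃ (Preimage e₂) → ∃ (Preimage e₃) → ⊥
      pigeonhole e₁ e₂ e₃ a₁₂ a₁₃ a₂₃ (t₁ , p₁@(_ , inj₁ d₁)) (t₂ , p₂@(_ , inj₁ d₂)) _ = preimages-apart e₁ e₂ {t₁} {t₂} a₁₂ p₁ p₂ d₁ d₂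
      pigeonhole e₁ e₂ e₃ a₁₂ a₁₃ a₂₃ (t₁ , p₁@(_ , inj₂ d₁)) (t₂ , p₂@(_ , inj₂ d₂)) _ = preimages-apart e₁ e₂ {t₁} {t₂} a₁₂ p₁ p₂ d₁ d₂
      pigeonhole e₁ e₂ e₃ a₁₂ a₁₃ a₂₃ (t₁ , p₁@(_ , inj₁ d₁)) (t₂ , (_ , inj₂ _)) (t₃ , p₃@(_ , inj₁ d₃)) = preimages-apart e₁ e₃ {t₁} {t₃} a₁₃ p₁ p₃ d₁ d₃
      pigeonhole e₁ e₂ e₃ a₁₂ a₁₃ a₂₃ (t₁ , p₁@(_ , inj₂ d₁)) (t₂ , (_ , inj₁ _)) (t₃ , p₃@(_ , inj₂ d₃)) = preimages-apart e₁ e₃ {t₁} {t₃} a₁₃ p₁ p₃ d₁ d₃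
      pigeonhole e₁ e₂ e₃ a₁₂ a₁₃ a₂₃ (t₁ , (_ , inj₁ _)) (t₂ , p₂@(_ , inj₂ d₂)) (t₃ , p₃@(_ , inj₂ d₃)) = preimages-apart e₂ e₃ {t₂} {t₃} a₂₃ p₂ p₃ d₂ d₃
      pigeonhole e₁ e₂ e₃ a₁₂ a₁₃ a₂₃ (t₁ , (_ , inj₂ _)) (t₂ , p₂@(_ , inj₁ d₂)) (t₃ , p₃@(_ , inj₁ d₃)) = preimages-apart e₂ e₃ {t₂} {t₃} a₂₃ p₂ p₃ d₂ d₃

      -- Any other image edge would have three distinct common neighbours, and their preimages would
      -- be three distinct common neighbours of i and i + 2.
      ±2-preserved : F σ i+2 - F σ i ≅ val (+ 2 , 0ℤ) [ N ] ⊎ F σ i+2 - F σ i ≅ val (- + 2 , 0ℤ) [ N ]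
      ±2-preserved = go (∈-set⁻ L (F σ i+2 - F σ i) (aut-difference σ aut i i+2 (subst (_∈ set L) (cong [_] (s i)) ([integer]∈ L 2∈L))))
        where
        s : ∀ i → + 2 ≡ 1ℤ + (1ℤ + i) - i
        s = solve-∀
        go : (∃ λ x → x ∈ₗ L × F σ i+2 - F σ i ≅ val x [ N ]) →
          F σ i+2 - F σ i ≅ val (+ 2 , 0ℤ) [ N ] ⊎ F σ i+2 - F σ i ≅ val (- + 2 , 0ℤ) [ N ]
        go (x , x∈ , d) = cases (All.lookup distinguished x∈)
          where
          cases : (Null (x ∸ (+ 2 , 0ℤ)) ⊎ Null (x ∸ (- + 2 , 0ℤ))) ⊎ ThreeApexes B L x →
            F σ i+2 - F σ i ≅ val (+ 2 , 0ℤ) [ N ] ⊎ F σ i+2 - F σ i ≅ val (- + 2 , 0ℤ) [ N ]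
          cases (inj₁ (inj₁ null)) = inj₁ (≅-trans (F σ i+2 - F σ i) (val x) (val (+ 2 , 0ℤ)) d (Null-∸⇒ x (+ 2 , 0ℤ) null))
          cases (inj₁ (inj₂ null)) = inj₂ (≅-trans (F σ i+2 - F σ i) (val x) (val (- + 2 , 0ℤ)) d (Null-∸⇒ x (- + 2 , 0ℤ) null))
          cases (inj₂ three) with find three
          ... | e₁ , e₁∈ , x-e₁ , rest with find rest
          ...   | e₂ , e₂∈ , (x-e₂ , a₁₂) , rest′ with find rest′
          ...     | e₃ , e₃∈ , x-e₃ , a₁₃ , a₂₃ = contradiction
            (common-neighbour x e₃ d e₃∈ x-e₃) (pigeonhole e₁ e₂ e₃ a₁₂ a₁₃ a₂₃ (common-neighbour x e₁ d e₁∈ x-e₁) (common-neighbour x e₂ d e₂∈ x-e₂))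

  opaque
    -- Two consecutive increments of σ add up to 2 or - 2 by `±2-preserved`, so they are equal.
    distinguished⇒normal : IsNormal m (set L)
    distinguished⇒normal = affine⇒normal λ σ aut → balanced⇒affine σ λ i →
      equal-steps (F σ (1ℤ + (1ℤ + i)) - F σ (1ℤ + i)) (F σ (1ℤ + i) - F σ i)
        (aut-difference σ aut (1ℤ + i) (1ℤ + (1ℤ + i)) (subst (_∈ set L) (cong [_] (s₁ (1ℤ + i))) ([integer]∈ L 1∈L)))
        (aut-difference σ aut i (1ℤ + i) (subst (_∈ set L) (cong [_] (s₁ i)) ([integer]∈ L 1∈L)))
        (Sum.map (subst (λ z → z ≅ val (+ 2 , 0ℤ) [ N ]) (s (F σ i) (F σ (1ℤ + i)) (F σ (1ℤ + (1ℤ + i)))))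
                 (subst (λ z → z ≅ val (- + 2 , 0ℤ) [ N ]) (s (F σ i) (F σ (1ℤ + i)) (F σ (1ℤ + (1ℤ + i)))))
                 (±2-preserved σ aut i))
      where
      s : ∀ x y z → z - x ≡ z - y + (y - x)
      s = solve-∀
      s₁ : ∀ i → 1ℤ ≡ 1ℤ + i - i
      s₁ = solve-∀

G G′ : List Symbol
G  = (1ℤ , 0ℤ) ∷ (- 1ℤ , 0ℤ) ∷ (1ℤ , 1ℤ) ∷ (- 1ℤ , 1ℤ) ∷ (+ 2 , 0ℤ) ∷ (- + 2 , 0ℤ) ∷ (0ℤ , 1ℤ) ∷ []
G′ = (1ℤ , 0ℤ) ∷ (- 1ℤ , 0ℤ) ∷ (1ℤ , 1ℤ) ∷ (- 1ℤ , 1ℤ) ∷ (+ 2 , 1ℤ) ∷ (- + 2 , 1ℤ) ∷ (0ℤ , 1ℤ) ∷ []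

opaque
  8∣n⇒¬NCI : ∀ m → 8 ∣ suc m → suc m ≢ 8 → ¬ NCI m
  8∣n⇒¬NCI m (ℕ∣.divides zero ()) _
  8∣n⇒¬NCI m (ℕ∣.divides 1 n≡8) n≢8 _ = n≢8 n≡8
  8∣n⇒¬NCI m (ℕ∣.divides (suc (suc q)) n≡) _ nci =
    doubling-free⇒¬CI G G′ (from-yes (Twists? G G′)) (from-yes (Twists? G′ G)) 1∈G 2∈G
      (from-yes (DoublingFree? 8 G′))
      (nci (set G) (ZeroFree⇒ G (from-yes (ZeroFree? 8 G)))
        (negation-closed⇒Symmetric G (from-yes (All.all? (λ x → negate x ∈ₛ? G) G)))
        (TwistedGraph.distinguished⇒normal m (2 ℕ.+ q) 8 n≡′ 8≤ G 1∈G 2∈G (from-yes (Apexes? 8 G)) (from-yes (Distinguished? 8 G))))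
    where
    1∈G : (1ℤ , 0ℤ) ∈ₗ G
    1∈G = here refl
    2∈G : (+ 2 , 0ℤ) ∈ₗ G
    2∈G = there (there (there (there (here refl))))
    n≡′ : + suc m ≡ + suc (suc q) * + 8
    n≡′ = trans (cong +_ n≡) (ℤₚ.pos-* (suc (suc q)) 8)
    -- First components of the tested combinations reach 6, beyond h = 4 for n = 8; from n = 16 on,
    -- h is at least 8.
    8≤ : 8 ℕ.≤ suc (suc q) ℕ.* 4
    8≤ = ℕₚ.m≤m+n 8 (q ℕ.* 4)
    open Twisted m (suc (suc q)) 8 n≡′ 8≤

theorem1p1 : (m : ℕ) →
    (NDCI m ⇔ (¬ (8 ∣ suc m)))
    × (NCI m ⇔ ((suc m ≡ 8) ⊎ (¬ (8 ∣ suc m))))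
theorem1p1 m =
  mk⇔ (λ ndci 8∣n → 8∣n⇒¬NDCI m 8∣n ndci) (8∤n⇒NDCI m) ,
  -- For 8 ∤ n the claim about graphs is a special case of the one about digraphs.
  mk⇔ nci⇒ λ { (inj₁ refl) → NCI-8 ; (inj₂ 8∤n) S 0∉S _ → 8∤n⇒NDCI m 8∤n S 0∉S }
  where
  nci⇒ : NCI m → suc m ≡ 8 ⊎ ¬ 8 ∣ suc m
  nci⇒ nci with suc m ℕ.≟ 8
  ... | yes n≡8 = inj₁ n≡8
  ... | no  n≢8 = inj₂ λ 8∣n → 8∣n⇒¬NCI m 8∣n n≢8 nci
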